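{- $\mathsf{PTAB}(\mathsf{S4.3}_t)=\{L^\pm,L^+,L^-,L^\circ,L^\uparrow\}$ and $|\mathsf{PTAB}(\mathsf{S4.3}_t)|=5$.
   Context: Tense formulas use $\Box$ (future necessity) and a past possibility operator written here $\mathsf{P}$; $\mathsf{S4}_t=\mathsf{K}_t\oplus\{\Box p\to p,\Box p\to\Box\Box p\}$. $\mathsf{S4.3}_t$ is the tense logic of all reflexive transitive linear frames (equivalently $\mathsf{S4}_t$ extended by the bounds forth-width 1, back-width 1, z-degree 1). A logic is pretabular if it is not the logic of a finite frame but all its consistent proper extensions are; $\mathsf{PTAB}(L)$ is the set of pretabular logics extending $L$. Let $\mathfrak{C}_n=(n,\geq)$ (reflexive transitive chain of $n$ points) and $L^\uparrow=\bigcap_{n\geq1}\mathsf{Log}(\mathfrak{C}_n)$. For a frame $\mathfrak{F}=(X,R)$, a point $x$ and $\lambda\leq\omega$, $\mathfrak{F}^x_\lambda$ is obtained by replacing $x$ by a cluster of $1+\lambda$ points each having exactly the $R$-successors and $R$-predecessors of $x$. Put $\mathfrak{C}^\circ_\lambda=(\mathfrak{C}_1)^0_\lambda$ (a single cluster), $\mathfrak{C}^+_\lambda=(\mathfrak{C}_2)^1_\lambda$ (a cluster seeing one reflexive point above it), $\mathfrak{C}^-_\lambda=(\mathfrak{C}_2)^0_\lambda$ (one reflexive point seeing a cluster above it), $\mathfrak{C}^\pm_\lambda=(\mathfrak{C}_3)^1_\lambda$ (point, cluster, point, in a chain), and $L^t=\mathsf{Log}(\mathfrak{C}^t_\omega)$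 for $t\in\{\pm,+,-,\circ\}$. -}

module Defs where

open import Level using (Level; 0ℓ) renaming (suc to lsuc)
open import Data.Nat using (ℕ; zero; suc; _≤_)
open import Data.Fin as Fin using (Fin; toℕ)
open import Data.Bool using (Bool; T)
open import Data.Unit using (⊤; tt)
open import Data.Empty using (⊥)
open import Data.Sum using (_⊎_; inj₁; inj₂)
open import Data.Product using (Σ; _×_; _,_)
open import Relation.Nullary using (¬_)

infixr 4 _⇒_
data Formula : Set where
  var : ℕ → Formula
  ⊥ᶠ  : Formula
  _⇒_ : Formula → Formula → Formula
  □   : Formula → Formula
  𝐏   : Formula → Formula

∼_ : Formula → Formula
∼ φ = φ ⇒ ⊥ᶠ

◇ : Formula → Formula
◇ φ = ∼ □ (∼ φ)

𝐇 : Formula → Formula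
𝐇 φ = ∼ 𝐏 (∼ φ)

subst : (ℕ → Formula) → Formula → Formula
subst σ (var n) = σ n
subst σ ⊥ᶠ      = ⊥ᶠ
subst σ (φ ⇒ ψ) = subst σ φ ⇒ subst σ ψ
subst σ (□ φ)   = □ (subst σ φ)
subst σ (𝐏 φ)   = 𝐏 (subst σ φ)

record Frame : Set₁ where
  field
    W : Set
    R : W → W → Set
open Frame public

Valuation : Frame → Set₁
Valuation F = ℕ → W F → Set

sat : (F : Frame) → Valuation F → W F → Formula → Set
sat F V x (var n) = V n x
sat F V x ⊥ᶠ      = ⊥
sat F V x (φ ⇒ ψ) = sat F V x φ → sat F V x ψ
sat F V x (□ φ)   = (y : W F) → R F x y → sat F V y φ
sat F V x (𝐏 φ)   = Σ (W F) λ y → R F y x × sat F V y φ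

Logic : Set₂
Logic = Formula → Set₁

Log : Frame → Logic
Log F φ = (V : Valuation F) (x : W F) → sat F V x φ

_⊆ᴸ_ : Logic → Logic → Set₁
L ⊆ᴸ L' = (φ : Formula) → L φ → L' φ

_≐_ : Logic → Logic → Set₁
L ≐ L' = (L ⊆ᴸ L') × (L' ⊆ᴸ L)

record IsTenseLogic (L : Logic) : Set₁ where
  field
    ax1  : ∀ φ ψ → L (φ ⇒ ψ ⇒ φ)
    ax2  : ∀ φ ψ χ → L ((φ ⇒ ψ ⇒ χ) ⇒ (φ ⇒ ψ) ⇒ φ ⇒ χ)
    ax3  : ∀ φ → L (∼ ∼ φ ⇒ φ)
    K□   : ∀ φ ψ → L (□ (φ ⇒ ψ) ⇒ □ φ ⇒ □ ψ)
    K𝐇   : ∀ φ ψ → L (𝐇 (φ ⇒ ψ) ⇒ 𝐇 φ ⇒ 𝐇 ψ)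
    conv₁ : ∀ φ → L (φ ⇒ □ (𝐏 φ))
    conv₂ : ∀ φ → L (φ ⇒ 𝐇 (◇ φ))
    mp   : ∀ φ ψ → L (φ ⇒ ψ) → L φ → L ψ
    nec□ : ∀ φ → L φ → L (□ φ)
    nec𝐇 : ∀ φ → L φ → L (𝐇 φ)
    us   : ∀ σ φ → L φ → L (subst σ φ)

Consistent : Logic → Set₁
Consistent L = ¬ L ⊥ᶠ

finFrame : (n : ℕ) → (Fin n → Fin n → Bool) → Frame
finFrame n r = record { W = Fin n ; R = λ i j → T (r i j) }

Tabular : Logic → Set₁
Tabular L = Σ ℕ λ n → Σ (Fin n → Fin n → Bool) λ r → L ≐ Log (finFrame n r)

Pretabular : Logic → Set₂
Pretabular L =
  ¬ Tabular L ×
  ((L' : Logic) → IsTenseLogic L' → L ⊆ᴸ L' → ¬ (L' ⊆ᴸ L) → Consistent L' → Tabular L')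

RTL : Frame → Set
RTL F = ((x : W F) → R F x x)
      × ((x y z : W F) → R F x y → R F y z → R F x z)
      × ((x y : W F) → R F x y ⊎ R F y x)

S4∙3t : Logic
S4∙3t φ = (F : Frame) → RTL F → Log F φ

PTAB-S4∙3t : Logic → Set₂
PTAB-S4∙3t L = IsTenseLogic L × (S4∙3t ⊆ᴸ L) × Pretabular L

Chain : ℕ → Frame
Chain n = record { W = Fin n ; R = λ i j → toℕ j ≤ toℕ i }

L↑ : Logic
L↑ φ = (n : ℕ) → Log (Chain (suc n)) φ

ranked : (X : Set) → (X → ℕ) → Frame
ranked X rk = record { W = X ; R = λ x y → rk x ≤ rk y }

C∘ : Frame
C∘ = ranked ℕ (λ _ → 0)

C⁺ : Frame
C⁺ = ranked (ℕ ⊎ ⊤) rk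
  where rk : ℕ ⊎ ⊤ → ℕ
        rk (inj₁ _) = 0
        rk (inj₂ _) = 1

C⁻ : Frame
C⁻ = ranked (⊤ ⊎ ℕ) rk
  where rk : ⊤ ⊎ ℕ → ℕ
        rk (inj₁ _) = 0
        rk (inj₂ _) = 1

C± : Frame
C± = ranked (⊤ ⊎ (ℕ ⊎ ⊤)) rk
  where rk : ⊤ ⊎ (ℕ ⊎ ⊤) → ℕ
        rk (inj₁ _)        = 0
        rk (inj₂ (inj₁ _)) = 1
        rk (inj₂ (inj₂ _)) = 2

five : Fin 5 → Logic
five Fin.zero                                    = Log C±
five (Fin.suc Fin.zero)                          = Log C⁺
five (Fin.suc (Fin.suc Fin.zero))                = Log C⁻
five (Fin.suc (Fin.suc (Fin.suc Fin.zero)))      = Log C∘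
five (Fin.suc (Fin.suc (Fin.suc (Fin.suc Fin.zero)))) = L↑

{-# OPTIONS --safe #-}
-- Every non-tabular tense logic L ⊇ S4.3_t lies below one of the five logics, and
-- these are pairwise incomparable; hence they are exactly the pretabular ones.
-- For the first claim, a component of the canonical frame of L is a linear
-- preorder M.  The layers of M cut out by strictly increasing □-definable
-- upsets give a bounded morphism from M onto a chain, so if L is not below L↑
-- then the number of clusters of M is bounded.  Then each cluster, and what lies
-- strictly above and below it, is definable, and collapsing the latter to single
-- points maps M onto a cluster frame of one of the four kinds; hence if L is not
-- below the corresponding Log C then the clusters are bounded as well.  So all
-- components of the canonical frame are finite of bounded size, and L is the
-- logic of the disjoint union of the finitely many frames of that size validating L.
module Submission where

open import Defs
open import Level using (0ℓ; lift; lower) renaming (suc to lsuc)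
open import Axiom.ExcludedMiddle using (ExcludedMiddle)
open import Data.Bool using (Bool; true; false; T; if_then_else_)
open import Data.Bool.Properties using (T?)
open import Data.Empty using (⊥; ⊥-elim)
open import Data.Fin as Fin using (Fin; toℕ; fromℕ; inject₁; _↑ˡ_; _↑ʳ_; splitAt)
open import Data.Fin.Patterns using (0F; 1F; 2F; 3F; 4F)
import Data.Fin.Properties as Fin
open import Data.Fin.Relation.Unary.Top using (view; ‵fromℕ; ‵inj₁)
open import Data.List using (List; []; _∷_; _++_; map; concatMap; cartesianProductWith; filter; length; lookup; upTo)
open import Data.List.Membership.Propositional using (_∈_)
open import Data.List.Membership.Propositional.Properties
  using (∈-map⁺; ∈-++⁺ˡ; ∈-++⁺ʳ; ∈-cartesianProductWith⁺; ∈-lookup; ∈-concatMap⁺; ∈-upTo⁺)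
open import Data.List.Relation.Unary.All as All using (All; []; _∷_)
import Data.List.Relation.Unary.All.Properties as All
open import Data.List.Relation.Unary.AllPairs using (AllPairs; []; _∷_)
import Data.List.Relation.Unary.AllPairs.Properties as AllPairs
open import Data.List.Relation.Unary.Any as Any using (Any; here; there)
import Data.List.Relation.Unary.Any.Properties as Any
open import Data.Nat using (ℕ; zero; suc; _+_; _*_; _⊔_; _≤_; _<_; z≤n; s≤s)
import Data.Nat.Properties as ℕ
open import Data.Product using (Σ; ∃; _×_; _,_; proj₁; proj₂)
open import Data.Sum using (_⊎_; inj₁; inj₂; [_,_]′)
open import Data.Unit using (⊤; tt)
open import Data.Vec as Vec using (Vec; []; _∷_)
import Data.Vec.Properties as Vec
open import Function using (_∘_; id; _⇔_; mk⇔; Equivalence)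
open import Function.Construct.Composition using (_⇔-∘_)
open import Function.Construct.Identity using (⇔-id)
open import Function.Construct.Symmetry using (⇔-sym)
open import Relation.Binary.PropositionalEquality
  using (_≡_; _≢_; refl; sym; trans; cong; cong₂) renaming (subst to transport; subst₂ to transport₂)
open import Relation.Nullary using (¬_; Dec; yes; no; ¬?; contradiction)
open import Relation.Nullary.Decidable using (map′; decidable-stable; ⌊_⌋; toWitness; fromWitness)

open Equivalence using (to; from)

-- Bisimulations

-- The restriction to variables below `K` matters because points of an infinite cluster are later
-- identified once they agree on the finitely many variables of one formula.
Below : ℕ → Formula → Set
Below K (var n) = n < K
Below K ⊥ᶠ      = ⊤
Below K (φ ⇒ ψ) = Below K φ × Below K ψ
Below K (□ φ)   = Below K φ
Below K (𝐏 φ)   = Below K φ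

varBound : Formula → ℕ
varBound (var n) = suc n
varBound ⊥ᶠ      = 0
varBound (φ ⇒ ψ) = varBound φ ⊔ varBound ψ
varBound (□ φ)   = varBound φ
varBound (𝐏 φ)   = varBound φ

below : ∀ {K} φ → varBound φ ≤ K → Below K φ
below (var n) p = p
below ⊥ᶠ      p = tt
below (φ ⇒ ψ) p = below φ (ℕ.≤-trans (ℕ.m≤m⊔n _ _) p) , below ψ (ℕ.≤-trans (ℕ.m≤n⊔m (varBound φ) _) p)
below (□ φ)   p = below φ p
below (𝐏 φ)   p = below φ p

record Bisimulation (F G : Frame) (V : Valuation F) (V′ : Valuation G) (K : ℕ) (Z : W F → W G → Set) : Set where
  field
    atom : ∀ {x y p} → Z x y → p < K → V p x ⇔ V′ p y
    zig  : ∀ {x y x′} → Z x y → R F x x′ → ∃ λ y′ → R G y y′ × Z x′ y′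
    zag  : ∀ {x y y′} → Z x y → R G y y′ → ∃ λ x′ → R F x x′ × Z x′ y′
    zig⁻ : ∀ {x y x′} → Z x y → R F x′ x → ∃ λ y′ → R G y′ y × Z x′ y′
    zag⁻ : ∀ {x y y′} → Z x y → R G y′ y → ∃ λ x′ → R F x′ x × Z x′ y′

module _ {F G : Frame} {V : Valuation F} {V′ : Valuation G} {K : ℕ} {Z : W F → W G → Set}
         (B : Bisimulation F G V V′ K Z) where
  open Bisimulation B

  sat-bisim : ∀ φ → Below K φ → ∀ {x y} → Z x y → sat F V x φ ⇔ sat G V′ y φ
  sat-bisim (var p) b z = atom z b
  sat-bisim ⊥ᶠ b z = ⇔-id _
  sat-bisim (φ ⇒ ψ) (b , b′) z = mk⇔
    (λ h s → to (sat-bisim ψ b′ z) (h (from (sat-bisim φ b z) s)))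
    (λ h s → from (sat-bisim ψ b′ z) (h (to (sat-bisim φ b z) s)))
  sat-bisim (□ φ) b z = mk⇔
    (λ h y′ r → let x′ , r′ , z′ = zag z r in to (sat-bisim φ b z′) (h x′ r′))
    (λ h x′ r → let y′ , r′ , z′ = zig z r in from (sat-bisim φ b z′) (h y′ r′))
  sat-bisim (𝐏 φ) b z = mk⇔
    (λ (x′ , r , s) → let y′ , r′ , z′ = zig⁻ z r in y′ , r′ , to (sat-bisim φ b z′) s)
    (λ (y′ , r , s) → let x′ , r′ , z′ = zag⁻ z r in x′ , r′ , from (sat-bisim φ b z′) s)

sat-subst : ∀ F V σ φ {x} → sat F V x (subst σ φ) ⇔ sat F (λ p y → sat F V y (σ p)) x φ
sat-subst F V σ (var p) = ⇔-id _
sat-subst F V σ ⊥ᶠ = ⇔-id _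
sat-subst F V σ (φ ⇒ ψ) = mk⇔
  (λ h s → to (sat-subst F V σ ψ) (h (from (sat-subst F V σ φ) s)))
  (λ h s → from (sat-subst F V σ ψ) (h (to (sat-subst F V σ φ) s)))
sat-subst F V σ (□ φ) = mk⇔
  (λ h y r → to (sat-subst F V σ φ) (h y r))
  (λ h y r → from (sat-subst F V σ φ) (h y r))
sat-subst F V σ (𝐏 φ) = mk⇔
  (λ (y , r , s) → y , r , to (sat-subst F V σ φ) s)
  (λ (y , r , s) → y , r , from (sat-subst F V σ φ) s)

subst-var : ∀ φ → subst var φ ≡ φ
subst-var (var n) = refl
subst-var ⊥ᶠ      = refl
subst-var (φ ⇒ ψ) = cong₂ _⇒_ (subst-var φ) (subst-var ψ)
subst-var (□ φ)   = cong □ (subst-var φ)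
subst-var (𝐏 φ)   = cong 𝐏 (subst-var φ)

-- Disjoint unions of finite frames

-- `up` and `down` close the image under successors and predecessors, so neither tense operator can
-- leave it.
record Component (F G : Frame) : Set where
  field
    emb   : W F → W G
    inj   : ∀ {x y} → emb x ≡ emb y → x ≡ y
    R⇔    : ∀ {x y} → R F x y ⇔ R G (emb x) (emb y)
    up    : ∀ {x z} → R G (emb x) z → ∃ λ y → emb y ≡ z
    down  : ∀ {x z} → R G z (emb x) → ∃ λ y → emb y ≡ z

module _ {F G : Frame} (C : Component F G) where
  open Component C

  component-bisim : ∀ {V V′ K} → (∀ p x → V p x ⇔ V′ p (emb x)) → Bisimulation F G V V′ K (λ x y → emb x ≡ y)
  component-bisim h = record
    { atom = λ { refl _ → h _ _ }
    ; zig  = λ { refl r → _ , to R⇔ r , refl }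
    ; zag  = λ { refl r → case-up (up r) r }
    ; zig⁻ = λ { refl r → _ , to R⇔ r , refl }
    ; zag⁻ = λ { refl r → case-down (down r) r }
    }
    where
    case-up : ∀ {x z} → (∃ λ y → emb y ≡ z) → R G (emb x) z → ∃ λ y → R F x y × emb y ≡ z
    case-up (y , refl) r = y , from R⇔ r , refl
    case-down : ∀ {x z} → (∃ λ y → emb y ≡ z) → R G z (emb x) → ∃ λ y → R F y x × emb y ≡ z
    case-down (y , refl) r = y , from R⇔ r , refl

  Log-component : Log G ⊆ᴸ Log F
  Log-component φ h V x = from
    (sat-bisim (component-bisim {V′ = λ p z → ∃ λ y → emb y ≡ z × V p y}
       (λ p y → mk⇔ (λ v → y , refl , v) (λ (y′ , e , v) → transport (V p) (inj e) v)))
     φ (below φ ℕ.≤-refl) refl)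
    (h _ (emb x))

  sat-component : ∀ {φ} → Log F φ → ∀ V x → sat G V (emb x) φ
  sat-component {φ} h V x = to
    (sat-bisim (component-bisim {V = λ p y → V p (emb y)} (λ _ _ → ⇔-id _)) φ (below φ ℕ.≤-refl) refl)
    (h _ x)

BoolRel : ℕ → Set
BoolRel n = Fin n → Fin n → Bool

-- A disjoint union validates exactly what both summands validate, so finitely many finite frames
-- can be merged into the single frame that `Tabular` demands.
sumRel : ∀ {m n} → BoolRel m → BoolRel n → BoolRel (m + n)
sumRel {m} {n} r s i j = go (splitAt m i) (splitAt m j)
  where
  go : Fin m ⊎ Fin n → Fin m ⊎ Fin n → Bool
  go (inj₁ i) (inj₁ j) = r i j
  go (inj₂ i) (inj₂ j) = s i j
  go _        _        = false

module _ {m n : ℕ} (r : BoolRel m) (s : BoolRel n) where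

  private
    Sum : Frame
    Sum = finFrame (m + n) (sumRel r s)

  sumˡ : Component (finFrame m r) Sum
  sumˡ = record
    { emb = _↑ˡ n ; inj = Fin.↑ˡ-injective n _ _
    ; R⇔ = λ {x} {y} → mk⇔ (transport T (sym (eq x y))) (transport T (eq x y))
    ; up = λ {x} {z} → up x z ; down = λ {x} {z} → down x z }
    where
    eq : ∀ x y → sumRel r s (x ↑ˡ n) (y ↑ˡ n) ≡ r x y
    eq x y rewrite Fin.splitAt-↑ˡ m x n | Fin.splitAt-↑ˡ m y n = refl
    up : ∀ x z → T (sumRel r s (x ↑ˡ n) z) → ∃ λ y → y ↑ˡ n ≡ z
    up x z t rewrite Fin.splitAt-↑ˡ m x n with splitAt m z in e
    ... | inj₁ y = y , Fin.splitAt⁻¹-↑ˡ e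
    down : ∀ x z → T (sumRel r s z (x ↑ˡ n)) → ∃ λ y → y ↑ˡ n ≡ z
    down x z t rewrite Fin.splitAt-↑ˡ m x n with splitAt m z in e
    ... | inj₁ y = y , Fin.splitAt⁻¹-↑ˡ e

  sumʳ : Component (finFrame n s) Sum
  sumʳ = record
    { emb = m ↑ʳ_ ; inj = Fin.↑ʳ-injective m _ _
    ; R⇔ = λ {x} {y} → mk⇔ (transport T (sym (eq x y))) (transport T (eq x y))
    ; up = λ {x} {z} → up x z ; down = λ {x} {z} → down x z }
    where
    eq : ∀ x y → sumRel r s (m ↑ʳ x) (m ↑ʳ y) ≡ s x y
    eq x y rewrite Fin.splitAt-↑ʳ m n x | Fin.splitAt-↑ʳ m n y = refl
    up : ∀ x z → T (sumRel r s (m ↑ʳ x) z) → ∃ λ y → m ↑ʳ y ≡ z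
    up x z t rewrite Fin.splitAt-↑ʳ m n x with splitAt m z in e
    ... | inj₂ y = y , Fin.splitAt⁻¹-↑ʳ e
    down : ∀ x z → T (sumRel r s z (m ↑ʳ x)) → ∃ λ y → m ↑ʳ y ≡ z
    down x z t rewrite Fin.splitAt-↑ʳ m n x with splitAt m z in e
    ... | inj₂ y = y , Fin.splitAt⁻¹-↑ʳ e

  Log-sum : ∀ {φ} → Log (finFrame m r) φ → Log (finFrame n s) φ → Log Sum φ
  Log-sum {φ} h h′ V x with splitAt m x in e
  ... | inj₁ y = transport (λ z → sat Sum V z φ) (Fin.splitAt⁻¹-↑ˡ e) (sat-component sumˡ {φ} h V y)
  ... | inj₂ y = transport (λ z → sat Sum V z φ) (Fin.splitAt⁻¹-↑ʳ e) (sat-component sumʳ {φ} h′ V y)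

-- Enumeration of finite frames

matrixRel : ∀ {k} → Vec (Vec Bool k) k → BoolRel k
matrixRel m i j = Vec.lookup (Vec.lookup m i) j

matrixFrame : ∀ {k} → Vec (Vec Bool k) k → Frame
matrixFrame {k} m = finFrame k (matrixRel m)

allVecs : {A : Set} → List A → ∀ n → List (Vec A n)
allVecs l zero    = [] ∷ []
allVecs l (suc n) = cartesianProductWith _∷_ l (allVecs l n)

∈-allVecs : ∀ {A : Set} {l : List A} → (∀ a → a ∈ l) → ∀ {n} (v : Vec A n) → v ∈ allVecs l n
∈-allVecs h []      = here refl
∈-allVecs h (a ∷ v) = ∈-cartesianProductWith⁺ _∷_ (h a) (∈-allVecs h v)

allMatrices : ∀ k → List (Vec (Vec Bool k) k)
allMatrices k = allVecs (allVecs (true ∷ false ∷ []) k) k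

∈-allMatrices : ∀ {k} (m : Vec (Vec Bool k) k) → m ∈ allMatrices k
∈-allMatrices = ∈-allVecs (∈-allVecs λ { true → here refl ; false → there (here refl) })

framesOfSize : ℕ → List (∃ BoolRel)
framesOfSize k = map (λ m → k , matrixRel m) (allMatrices k)

-- Only relations of the form `matrixRel m` are listed, so that membership is a propositional
-- equality and never requires identifying functions that agree pointwise.
finiteFrames : ℕ → List (∃ BoolRel)
finiteFrames N = concatMap framesOfSize (upTo (suc N))

∈-finiteFrames : ∀ {N k} → k ≤ N → (m : Vec (Vec Bool k) k) → (k , matrixRel m) ∈ finiteFrames N
∈-finiteFrames {k = k} k≤N m = ∈-concatMap⁺ framesOfSize
  (Any.map (λ { refl → ∈-map⁺ (λ m → k , matrixRel m) (∈-allMatrices m) }) (∈-upTo⁺ (s≤s k≤N)))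

-- Frames with a distinguished cluster

data Cover {A : Set} (c : ℕ → A) (hi lo : A) (Hi Lo : Set) (g : A) : Set where
  on-cluster : ∀ n → g ≡ c n → Cover c hi lo Hi Lo g
  on-hi      : g ≡ hi → Hi → Cover c hi lo Hi Lo g
  on-lo      : g ≡ lo → Lo → Cover c hi lo Hi Lo g

-- Hi and Lo say whether there are points above and below the cluster;
-- hi and lo are junk when these fail.
record ClusterFrame (G : Frame) (c : ℕ → W G) (Hi Lo : Set) : Set where
  field
    rk    : W G → ℕ
    R⇔    : ∀ {g h} → R G g h ⇔ rk g ≤ rk h
    hi lo : W G
    rk-c  : ∀ n → rk (c n) ≡ 1
    rk-hi : Hi → rk hi ≡ 2
    rk-lo : Lo → rk lo ≡ 0
    cover : ∀ g → Cover c hi lo Hi Lo g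

c± : ℕ → W C±
c± n = inj₂ (inj₁ n)

c⁺ : ℕ → W C⁺
c⁺ = inj₁

c⁻ : ℕ → W C⁻
c⁻ = inj₂

c∘ : ℕ → W C∘
c∘ = id

module _ {Hi Lo : Set} where

  -- The shift `s` puts the cluster at rank 1 in all four frames: it is 1 exactly where no point
  -- lies below the cluster.
  rankedCluster : ∀ {X rk c} s hi lo → (∀ n → s + rk (c n) ≡ 1) → (Hi → s + rk hi ≡ 2) → (Lo → s + rk lo ≡ 0) →
                  (∀ g → Cover c hi lo Hi Lo g) → ClusterFrame (ranked X rk) c Hi Lo
  rankedCluster {rk = rk} s hi lo p q r cover = record
    { rk = λ g → s + rk g ; R⇔ = mk⇔ (ℕ.+-monoʳ-≤ s) (ℕ.+-cancelˡ-≤ s _ _)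
    ; hi = hi ; lo = lo ; rk-c = p ; rk-hi = q ; rk-lo = r ; cover = cover }

  C±-cluster : Hi → Lo → ClusterFrame C± c± Hi Lo
  C±-cluster h k = rankedCluster 0 (inj₂ (inj₂ tt)) (inj₁ tt) (λ _ → refl) (λ _ → refl) (λ _ → refl)
    λ { (inj₁ _) → on-lo refl k ; (inj₂ (inj₁ n)) → on-cluster n refl ; (inj₂ (inj₂ _)) → on-hi refl h }

  C⁺-cluster : Hi → ¬ Lo → ClusterFrame C⁺ c⁺ Hi Lo
  C⁺-cluster h k = rankedCluster 1 (inj₂ tt) (c⁺ 0) (λ _ → refl) (λ _ → refl) (⊥-elim ∘ k)
    λ { (inj₁ n) → on-cluster n refl ; (inj₂ _) → on-hi refl h }

  C⁻-cluster : ¬ Hi → Lo → ClusterFrame C⁻ c⁻ Hi Lo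
  C⁻-cluster h k = rankedCluster 0 (c⁻ 0) (inj₁ tt) (λ _ → refl) (⊥-elim ∘ h) (λ _ → refl)
    λ { (inj₁ _) → on-lo refl k ; (inj₂ n) → on-cluster n refl }

  C∘-cluster : ¬ Hi → ¬ Lo → ClusterFrame C∘ c∘ Hi Lo
  C∘-cluster h k = rankedCluster 1 0 0 (λ _ → refl) (⊥-elim ∘ h) (⊥-elim ∘ k) λ n → on-cluster n refl

nth : List ℕ → ℕ → ℕ
nth []      _       = 0
nth (x ∷ _) zero    = x
nth (_ ∷ l) (suc i) = nth l i

nth-Any : ∀ {P : ℕ → Set} {l} → Any P l → ∃ λ i → i < length l × P (nth l i)
nth-Any (here p)  = 0 , s≤s z≤n , p
nth-Any (there a) = let i , q , p = nth-Any a in suc i , s≤s q , p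

-- Formulas separating the five logics

-- A variant of the bounded-depth axioms: on preorders, a refutation of `bd n` needs `n + 1`
-- strictly ascending points, since `∼ ◇ (var n)` excludes seeing the earlier point where `var n`
-- held.
bd : ℕ → Formula
bd zero    = ⊥ᶠ
bd (suc n) = var n ⇒ □ (∼ ◇ (var n) ⇒ bd n)

bd-valid : ∀ {X rk r} → (∀ x → rk x ≤ r) → ∀ n V x → r < rk x + n → sat (ranked X rk) V x (bd n)
bd-valid {rk = rk} {r} b zero V x p =
  contradiction (b x) (ℕ.<⇒≱ (transport (r <_) (ℕ.+-identityʳ (rk x)) p))
bd-valid {rk = rk} {r} b (suc n) V x p v y x≤y ¬◇ with rk y ℕ.≤? rk x
... | yes s = ⊥-elim (¬◇ λ k → k x s v)
... | no ¬s = bd-valid b n V y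
  (ℕ.<-≤-trans (transport (r <_) (ℕ.+-suc (rk x) n) p) (ℕ.+-monoˡ-≤ n (ℕ.≰⇒> ¬s)))

-- For positive `n` the outermost variable of `bd n` has index `n - 1` and must hold at the start
-- `u n`; hence `var p` is true only at `u (suc p)`. Each round then moves up from `u (suc n)` to
-- `u n`.
bd-refuted : ∀ F (u : ℕ → W F) n → (∀ i → i < n → R F (u (suc i)) (u i) × ¬ R F (u i) (u (suc i))) →
             ¬ sat F (λ p y → y ≡ u (suc p)) (u n) (bd n)
bd-refuted F u (suc n) desc h =
  bd-refuted F u n (λ i p → desc i (ℕ.m<n⇒m<1+n p))
    (h refl (u n) (proj₁ (desc n ℕ.≤-refl)) λ d → d λ { z r refl → proj₂ (desc n ℕ.≤-refl) r })

-- The negated conjunction of `f 0` up to `f (n - 1)`. Written with nested implications, its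
-- semantics is provable without excluded middle.
refutations : (ℕ → Formula) → ℕ → Formula
refutations f zero    = ⊥ᶠ
refutations f (suc n) = f n ⇒ refutations f n

sat-refutations : ∀ F V f n {x} → sat F V x (refutations f n) ⇔ (¬ (∀ i → i < n → sat F V x (f i)))
sat-refutations F V f zero = mk⇔ (λ h _ → h) (λ n → n λ _ ())
sat-refutations F V f (suc n) = mk⇔
  (λ h k → to (sat-refutations F V f n) (h (k n ℕ.≤-refl)) λ i p → k i (ℕ.m<n⇒m<1+n p))
  (λ h s → from (sat-refutations F V f n) λ k → h λ i p →
    [ k i , (λ { refl → s }) ]′ (ℕ.m<1+n⇒m<n∨m≡n p))

notNew : ℕ → Formula
notNew k = var k ⇒ refutations (∼_ ∘ var) k

-- Refutable at a point iff it sees more than n points.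
pigeons : ℕ → Formula
pigeons n = refutations (λ k → ∼ □ (notNew k)) (suc n)

pigeons-refuted : ∀ F V n x → (∀ i → i ≤ n → ∃ λ y → R F x y × V i y × (∀ j → j < i → ¬ V j y)) →
                  ¬ sat F V x (pigeons n)
pigeons-refuted F V n x h s = to (sat-refutations F V _ (suc n)) s λ i i≤n b →
  let y , r , v , new = h i (ℕ.≤-pred i≤n) in to (sat-refutations F V _ i) (b y r v) new

-- The McKinsey axiom in negative form. On a linear preorder with a last cluster it holds just when
-- that cluster is a single point; `mckinsey⁻` is the mirror image for the first cluster.
mckinsey : Formula
mckinsey = □ (◇ (var 0)) ⇒ □ (◇ (∼ var 0)) ⇒ ⊥ᶠ

mckinsey-valid : ∀ F t → (∀ x → R F x t) → (∀ y → R F t y → y ≡ t) → Log F mckinsey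
mckinsey-valid F t fin only V x h k = h t (fin x) λ y r v → k t (fin x) λ y′ r′ n →
  n (transport (V 0) (trans (only y r) (sym (only y′ r′))) v)

mckinsey-refuted : ∀ F a b → a ≢ b → (∀ y → R F y a) → (∀ y → R F y b) → ¬ Log F mckinsey
mckinsey-refuted F a b a≢b ra rb h =
  h (λ _ y → y ≡ a) a (λ y _ d → d a (ra y) refl) (λ y _ d → d b (rb y) (λ e → a≢b (sym e)))

mckinsey⁻ : Formula
mckinsey⁻ = 𝐇 (𝐏 (var 0)) ⇒ 𝐇 (𝐏 (∼ var 0)) ⇒ ⊥ᶠ

mckinsey⁻-valid : ∀ F t → (∀ x → R F t x) → (∀ y → R F y t → y ≡ t) → Log F mckinsey⁻
mckinsey⁻-valid F t init only V x h k =
  h (t , init x , λ (y , r , v) → k (t , init x , λ (y′ , r′ , n) →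
    n (transport (V 0) (trans (only y r) (sym (only y′ r′))) v)))

mckinsey⁻-refuted : ∀ F a b → a ≢ b → (∀ y → R F a y) → (∀ y → R F b y) → ¬ Log F mckinsey⁻
mckinsey⁻-refuted F a b a≢b ra rb h =
  h (λ _ y → y ≡ a) a (λ (y , _ , n) → n (a , ra y , refl)) (λ (y , _ , n) → n (b , rb y , λ e → a≢b (sym e)))

grzegorczyk : Formula
grzegorczyk = □ (□ (var 0 ⇒ □ (var 0)) ⇒ var 0) ⇒ var 0

-- Induction along the chain: proper successors of `x` have smaller indices and already satisfy
-- `var 0`. So a step from `z` to `u` could lose `var 0` only if `u` is `x`, and then `z` is `x` too
-- by antisymmetry.
grzegorczyk-valid : ∀ n → Log (Chain n) grzegorczyk
grzegorczyk-valid n V x h = go (suc (toℕ x)) x ℕ.≤-refl h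
  where
  go : ∀ m x → toℕ x < m → sat (Chain n) V x (□ (□ (var 0 ⇒ □ (var 0)) ⇒ var 0)) → V 0 x
  go (suc m) x x<m h = h x ℕ.≤-refl λ z z≤x v u u≤z →
    [ (λ u<x → go m u (ℕ.<-≤-trans u<x (ℕ.≤-pred x<m)) (λ y y≤u → h y (ℕ.≤-trans y≤u (ℕ.<⇒≤ u<x))))
    , (λ u≡x → transport (V 0) (Fin.toℕ-injective (ℕ.≤-antisym (ℕ.≤-trans z≤x (ℕ.≤-reflexive (sym u≡x))) u≤z)) v)
    ]′ (ℕ.m≤n⇒m<n∨m≡n (ℕ.≤-trans u≤z z≤x))

grzegorczyk-refuted : ∀ F a b → a ≢ b → R F a a → R F a b → R F b a → ¬ Log F grzegorczyk
grzegorczyk-refuted F a b a≢b aa ab ba h = h (λ _ y → y ≢ a) a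
  (λ { y _ k refl → k b ab (λ e → a≢b (sym e)) a ba refl }) refl

-- Consistency, unbounded size and incomparability of the five logics

ranked-RTL : ∀ {X rk} → RTL (ranked X rk)
ranked-RTL {rk = rk} =
  (λ _ → ℕ.≤-refl) , (λ _ _ _ → ℕ.≤-trans) , λ x y → ℕ.≤-total (rk x) (rk y)

Chain-RTL : ∀ n → RTL (Chain n)
Chain-RTL n = (λ _ → ℕ.≤-refl) , (λ _ _ _ r s → ℕ.≤-trans s r) , λ x y → ℕ.≤-total (toℕ y) (toℕ x)

S4∙3t⊆five : ∀ i → S4∙3t ⊆ᴸ five i
S4∙3t⊆five 0F φ h   = h C± ranked-RTL
S4∙3t⊆five 1F φ h   = h C⁺ ranked-RTL
S4∙3t⊆five 2F φ h   = h C⁻ ranked-RTL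
S4∙3t⊆five 3F φ h   = h C∘ ranked-RTL
S4∙3t⊆five 4F φ h n = h (Chain (suc n)) (Chain-RTL (suc n))

five-consistent : ∀ i → Consistent (five i)
five-consistent 0F h = h (λ _ _ → ⊤) (c± 0)
five-consistent 1F h = h (λ _ _ → ⊤) (c⁺ 0)
five-consistent 2F h = h (λ _ _ → ⊤) (c⁻ 0)
five-consistent 3F h = h (λ _ _ → ⊤) (c∘ 0)
five-consistent 4F h = h 0 (λ _ _ → ⊤) Fin.zero

cluster-pigeons : ∀ F (c : ℕ → W F) x → (∀ {i j} → c i ≡ c j → i ≡ j) → (∀ i → R F x (c i)) → ∀ n → ¬ Log F (pigeons n)
cluster-pigeons F c x inj r n h = pigeons-refuted F (λ p y → y ≡ c p) n x
  (λ i _ → c i , r i , refl , λ j j<i e → ℕ.<⇒≢ j<i (sym (inj e))) (h _ x)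

-- This makes the five logics non-tabular, as `pigeons n` is valid on every frame with `n` points:
-- four of the logics have a frame with an infinite cluster, and `L↑` has arbitrarily long chains.
five-pigeons : ∀ i n → ¬ five i (pigeons n)
five-pigeons 0F   = cluster-pigeons C± c± (c± 0) (λ { refl → refl }) (λ _ → ℕ.≤-refl)
five-pigeons 1F   = cluster-pigeons C⁺ c⁺ (c⁺ 0) (λ { refl → refl }) (λ _ → ℕ.≤-refl)
five-pigeons 2F   = cluster-pigeons C⁻ c⁻ (c⁻ 0) (λ { refl → refl }) (λ _ → ℕ.≤-refl)
five-pigeons 3F   = cluster-pigeons C∘ c∘ 0 id (λ _ → ℕ.≤-refl)
five-pigeons 4F n h = pigeons-refuted (Chain (suc n)) (λ p y → toℕ y ≡ p) n (fromℕ n)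
  (λ i i≤n → Fin.fromℕ< (s≤s i≤n) ,
     ℕ.≤-trans (Fin.toℕ≤pred[n] (Fin.fromℕ< (s≤s i≤n))) (ℕ.≤-reflexive (sym (Fin.toℕ-fromℕ n))) ,
     Fin.toℕ-fromℕ< (s≤s i≤n) ,
     λ j j<i e → ℕ.<⇒≢ j<i (trans (sym e) (Fin.toℕ-fromℕ< (s≤s i≤n))))
  (h n _ (fromℕ n))

desc± : ℕ → W C±
desc± 0 = inj₂ (inj₂ tt)
desc± 1 = c± 0
desc± _ = inj₁ tt

C±-¬bd : ∀ n → n ≤ 2 → ¬ Log C± (bd n)
C±-¬bd n n≤2 h = bd-refuted C± desc± n (λ i i<n → desc i (ℕ.<-≤-trans i<n n≤2)) (h _ _)
  where
  desc : ∀ i → i < 2 → R C± (desc± (suc i)) (desc± i) × ¬ R C± (desc± i) (desc± (suc i))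
  desc 0 _ = s≤s z≤n , λ { (s≤s ()) }
  desc 1 _ = z≤n , λ ()
  desc (suc (suc _)) (s≤s (s≤s ()))

C⁺-¬bd : ¬ Log C⁺ (bd 1)
C⁺-¬bd h = bd-refuted C⁺ desc⁺ 1 (λ { 0 _ → z≤n , (λ ()) ; (suc _) (s≤s ()) }) (h (λ p y → y ≡ desc⁺ (suc p)) _)
  where
  desc⁺ : ℕ → W C⁺
  desc⁺ 0 = inj₂ tt
  desc⁺ _ = c⁺ 0

C⁻-¬bd : ¬ Log C⁻ (bd 1)
C⁻-¬bd h = bd-refuted C⁻ desc⁻ 1 (λ { 0 _ → z≤n , (λ ()) ; (suc _) (s≤s ()) }) (h (λ p y → y ≡ desc⁻ (suc p)) _)
  where
  desc⁻ : ℕ → W C⁻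
  desc⁻ 0 = c⁻ 0
  desc⁻ _ = inj₁ tt

L↑-¬bd : ∀ n → ¬ L↑ (bd n)
L↑-¬bd n h = bd-refuted (Chain (suc n)) u n desc (h n _ _)
  where
  u : ℕ → Fin (suc n)
  u i = Fin.fromℕ< (s≤s (ℕ.m⊓n≤n i n))
  toℕ-u : ∀ {i} → i ≤ n → toℕ (u i) ≡ i
  toℕ-u i≤n = trans (Fin.toℕ-fromℕ< _) (ℕ.m≤n⇒m⊓n≡m i≤n)
  desc : ∀ i → i < n → toℕ (u i) ≤ toℕ (u (suc i)) × ¬ toℕ (u (suc i)) ≤ toℕ (u i)
  desc i i<n rewrite toℕ-u i<n | toℕ-u (ℕ.<⇒≤ i<n) = ℕ.n≤1+n i , ℕ.1+n≰n

C±-bd : Log C± (bd 3)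
C±-bd V x = bd-valid {r = 2} (λ { (inj₁ _) → z≤n ; (inj₂ (inj₁ _)) → s≤s z≤n ; (inj₂ (inj₂ _)) → s≤s (s≤s z≤n) }) 3 V x
  (ℕ.m≤n+m 3 _)

C⁺-bd : Log C⁺ (bd 2)
C⁺-bd V x = bd-valid {r = 1} (λ { (inj₁ _) → z≤n ; (inj₂ _) → s≤s z≤n }) 2 V x (ℕ.m≤n+m 2 _)

C⁻-bd : Log C⁻ (bd 2)
C⁻-bd V x = bd-valid {r = 1} (λ { (inj₁ _) → z≤n ; (inj₂ _) → s≤s z≤n }) 2 V x (ℕ.m≤n+m 2 _)

C∘-bd : Log C∘ (bd 1)
C∘-bd V x = bd-valid {r = 0} (λ _ → z≤n) 1 V x (ℕ.m≤n+m 1 0)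

C±-mckinsey : Log C± mckinsey
C±-mckinsey = mckinsey-valid C± (inj₂ (inj₂ tt))
  (λ { (inj₁ _) → z≤n ; (inj₂ (inj₁ _)) → s≤s z≤n ; (inj₂ (inj₂ _)) → ℕ.≤-refl })
  (λ { (inj₁ _) () ; (inj₂ (inj₁ _)) (s≤s ()) ; (inj₂ (inj₂ _)) _ → refl })

C⁺-mckinsey : Log C⁺ mckinsey
C⁺-mckinsey = mckinsey-valid C⁺ (inj₂ tt)
  (λ { (inj₁ _) → z≤n ; (inj₂ _) → ℕ.≤-refl }) (λ { (inj₁ _) () ; (inj₂ _) _ → refl })

C⁻-¬mckinsey : ¬ Log C⁻ mckinsey
C⁻-¬mckinsey = mckinsey-refuted C⁻ (c⁻ 0) (c⁻ 1) (λ ())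
  (λ { (inj₁ _) → z≤n ; (inj₂ _) → ℕ.≤-refl }) (λ { (inj₁ _) → z≤n ; (inj₂ _) → ℕ.≤-refl })

C∘-¬mckinsey : ¬ Log C∘ mckinsey
C∘-¬mckinsey = mckinsey-refuted C∘ 0 1 (λ ()) (λ _ → z≤n) (λ _ → z≤n)

C±-mckinsey⁻ : Log C± mckinsey⁻
C±-mckinsey⁻ = mckinsey⁻-valid C± (inj₁ tt) (λ _ → z≤n)
  (λ { (inj₁ _) _ → refl ; (inj₂ (inj₁ _)) () ; (inj₂ (inj₂ _)) () })

C⁻-mckinsey⁻ : Log C⁻ mckinsey⁻
C⁻-mckinsey⁻ = mckinsey⁻-valid C⁻ (inj₁ tt) (λ _ → z≤n) (λ { (inj₁ _) _ → refl ; (inj₂ _) () })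

C⁺-¬mckinsey⁻ : ¬ Log C⁺ mckinsey⁻
C⁺-¬mckinsey⁻ = mckinsey⁻-refuted C⁺ (c⁺ 0) (c⁺ 1) (λ ()) (λ _ → z≤n) (λ _ → z≤n)

C∘-¬mckinsey⁻ : ¬ Log C∘ mckinsey⁻
C∘-¬mckinsey⁻ = mckinsey⁻-refuted C∘ 0 1 (λ ()) (λ _ → z≤n) (λ _ → z≤n)

cluster-¬grzegorczyk : ∀ {X rk} (a b : X) → a ≢ b → rk a ≡ rk b → ¬ Log (ranked X rk) grzegorczyk
cluster-¬grzegorczyk a b n e = grzegorczyk-refuted _ a b n ℕ.≤-refl (ℕ.≤-reflexive e) (ℕ.≤-reflexive (sym e))

-- `bd` compares numbers of clusters, the two McKinsey formulas detect whether the last or the first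
-- cluster is a single point, and `grzegorczyk` belongs to `L↑` but fails wherever there is a proper
-- cluster.
five-incomparable : ∀ i j → five i ⊆ᴸ five j → i ≡ j
five-incomparable 0F 0F s = refl
five-incomparable 0F 1F s = ⊥-elim (C⁺-¬mckinsey⁻ (s mckinsey⁻ C±-mckinsey⁻))
five-incomparable 0F 2F s = ⊥-elim (C⁻-¬mckinsey (s mckinsey C±-mckinsey))
five-incomparable 0F 3F s = ⊥-elim (C∘-¬mckinsey (s mckinsey C±-mckinsey))
five-incomparable 0F 4F s = ⊥-elim (L↑-¬bd 3 (s (bd 3) C±-bd))
five-incomparable 1F 0F s = ⊥-elim (C±-¬bd 2 ℕ.≤-refl (s (bd 2) C⁺-bd))
five-incomparable 1F 1F s = refl
five-incomparable 1F 2F s = ⊥-elim (C⁻-¬mckinsey (s mckinsey C⁺-mckinsey))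
five-incomparable 1F 3F s = ⊥-elim (C∘-¬mckinsey (s mckinsey C⁺-mckinsey))
five-incomparable 1F 4F s = ⊥-elim (L↑-¬bd 2 (s (bd 2) C⁺-bd))
five-incomparable 2F 0F s = ⊥-elim (C±-¬bd 2 ℕ.≤-refl (s (bd 2) C⁻-bd))
five-incomparable 2F 1F s = ⊥-elim (C⁺-¬mckinsey⁻ (s mckinsey⁻ C⁻-mckinsey⁻))
five-incomparable 2F 2F s = refl
five-incomparable 2F 3F s = ⊥-elim (C∘-¬mckinsey⁻ (s mckinsey⁻ C⁻-mckinsey⁻))
five-incomparable 2F 4F s = ⊥-elim (L↑-¬bd 2 (s (bd 2) C⁻-bd))
five-incomparable 3F 0F s = ⊥-elim (C±-¬bd 1 (s≤s z≤n) (s (bd 1) C∘-bd))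
five-incomparable 3F 1F s = ⊥-elim (C⁺-¬bd (s (bd 1) C∘-bd))
five-incomparable 3F 2F s = ⊥-elim (C⁻-¬bd (s (bd 1) C∘-bd))
five-incomparable 3F 3F s = refl
five-incomparable 3F 4F s = ⊥-elim (L↑-¬bd 1 (s (bd 1) C∘-bd))
five-incomparable 4F 0F s = ⊥-elim (cluster-¬grzegorczyk (c± 0) (c± 1) (λ ()) refl (s grzegorczyk (grzegorczyk-valid ∘ suc)))
five-incomparable 4F 1F s = ⊥-elim (cluster-¬grzegorczyk (c⁺ 0) (c⁺ 1) (λ ()) refl (s grzegorczyk (grzegorczyk-valid ∘ suc)))
five-incomparable 4F 2F s = ⊥-elim (cluster-¬grzegorczyk (c⁻ 0) (c⁻ 1) (λ ()) refl (s grzegorczyk (grzegorczyk-valid ∘ suc)))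
five-incomparable 4F 3F s = ⊥-elim (cluster-¬grzegorczyk (c∘ 0) (c∘ 1) (λ ()) refl (s grzegorczyk (grzegorczyk-valid ∘ suc)))
five-incomparable 4F 4F s = refl

-- Similar points are interchangeable for formulas in the first `K` variables, so a map into a frame
-- with an infinite cluster need only be onto up to similarity.
Similar : (G : Frame) → Valuation G → ℕ → W G → W G → Set
Similar G V K g g′ = R G g g′ × R G g′ g × (∀ p → p < K → V p g ⇔ V p g′)

Similar-refl : ∀ {G} → RTL G → ∀ V {K g} → Similar G V K g g
Similar-refl (rf , _) V = rf _ , rf _ , λ _ _ → ⇔-id _

≡⇒Similar : ∀ {G} → RTL G → ∀ V {K g g′} → g ≡ g′ → Similar G V K g g′
≡⇒Similar rtl V refl = Similar-refl rtl V

module Classical (em₂ : ExcludedMiddle (lsuc (lsuc 0ℓ))) where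

  em₁ : ExcludedMiddle (lsuc 0ℓ)
  em₁ = map′ lower (lift {ℓ = lsuc (lsuc 0ℓ)}) em₂

  em₀ : ExcludedMiddle 0ℓ
  em₀ = map′ lower (lift {ℓ = lsuc 0ℓ}) em₁

  dne : {P : Set} → ¬ ¬ P → P
  dne = decidable-stable em₀

  dne₁ : {P : Set₁} → ¬ ¬ P → P
  dne₁ = decidable-stable em₁

  ¬∀⇒∃¬ : {A : Set} {P Q : A → Set} → ¬ (∀ a → P a → Q a) → ∃ λ a → P a × ¬ Q a
  ¬∀⇒∃¬ h = dne λ n → h λ a p → dne λ ¬q → n (a , p , ¬q)

  char : {A : Set} → (A → Set) → A → Bool
  char P a = ⌊ em₀ {P a} ⌋

  char⇔ : {A : Set} (P : A → Set) (a : A) → T (char P a) ⇔ P a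
  char⇔ P a = mk⇔ (toWitness {a? = em₀ {P a}}) (fromWitness {a? = em₀ {P a}})

  module _ {F G : Frame} (totalF : ∀ x y → R F x y ⊎ R F y x) (rtl : RTL G)
           {V : Valuation F} {V′ : Valuation G} {K : ℕ} (f : W F → W G) where

    private
      transG = proj₁ (proj₂ rtl)
      _~_ = Similar G V′ K

    -- Since both frames are linear, a monotone map reaching every point up to similarity
    -- satisfies the back conditions between different clusters for free.
    monotone-bisim :
      (∀ {x p} → V p x ⇔ V′ p (f x)) →
      (∀ {x y} → R F x y → R G (f x) (f y)) →
      (∀ g → ∃ λ x → f x ~ g) →
      (∀ x g → R G (f x) g → R G g (f x) → ∃ λ y → R F x y × R F y x × f y ~ g) →
      Bisimulation F G V V′ K (λ x g → f x ~ g)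
    monotone-bisim atom mono surj same = record
      { atom = λ (_ , _ , h) p → h _ p ⇔-∘ atom
      ; zig  = λ {x} {g} {x′} (_ , s , _) r → f x′ , transG _ _ _ s (mono r) , Similar-refl rtl V′
      ; zag  = λ (s , _ , _) r → zag (transG _ _ _ s r)
      ; zig⁻ = λ {x} {g} {x′} (s , _ , _) r → f x′ , transG _ _ _ (mono r) s , Similar-refl rtl V′
      ; zag⁻ = λ (_ , s , _) r → zag⁻ (transG _ _ _ r s)
      }
      where
      zag : ∀ {x g} → R G (f x) g → ∃ λ y → R F x y × f y ~ g
      zag {x} {g} r with em₀ {R G g (f x)}
      ... | yes r′ = let y , s , _ , e = same x g r r′ in y , s , e
      ... | no ¬r′ with surj g
      ...   | y , e with totalF x y
      ...     | inj₁ s = y , s , e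
      ...     | inj₂ s = contradiction (transG _ _ _ (proj₁ (proj₂ e)) (mono s)) ¬r′
      zag⁻ : ∀ {x g} → R G g (f x) → ∃ λ y → R F y x × f y ~ g
      zag⁻ {x} {g} r with em₀ {R G (f x) g}
      ... | yes r′ = let y , _ , s , e = same x g r′ r in y , s , e
      ... | no ¬r′ with surj g
      ...   | y , e with totalF y x
      ...     | inj₁ s = y , s , e
      ...     | inj₂ s = contradiction (transG _ _ _ (mono s) (proj₁ e)) ¬r′

  Log-tense : ∀ F → IsTenseLogic (Log F)
  Log-tense F = record
    { ax1   = λ φ ψ V x s _ → s
    ; ax2   = λ φ ψ χ V x f g s → f s (g s)
    ; ax3   = λ φ V x → dne
    ; K□    = λ φ ψ V x f g y r → f y r (g y r)
    ; K𝐇    = λ φ ψ V x f g (y , r , ¬ψ) → g (y , r , λ s → f (y , r , λ h → ¬ψ (h s)))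
    ; conv₁ = λ φ V x s y r → x , r , s
    ; conv₂ = λ φ V x s (y , r , ¬◇) → ¬◇ λ b → b x r s
    ; mp    = λ φ ψ f g V x → f V x (g V x)
    ; nec□  = λ φ h V x y r → h V y
    ; nec𝐇  = λ φ h V x (y , r , ¬s) → ¬s (h V y)
    ; us    = λ σ φ h V x → from (sat-subst F V σ φ) (h _ x)
    }

  ⋂-tense : {I : Set} (F : I → Frame) → IsTenseLogic (λ φ → ∀ i → Log (F i) φ)
  ⋂-tense F = record
    { ax1   = λ φ ψ i → ax1 (tense i) φ ψ
    ; ax2   = λ φ ψ χ i → ax2 (tense i) φ ψ χ
    ; ax3   = λ φ i → ax3 (tense i) φ
    ; K□    = λ φ ψ i → K□ (tense i) φ ψ
    ; K𝐇    = λ φ ψ i → K𝐇 (tense i) φ ψ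
    ; conv₁ = λ φ i → conv₁ (tense i) φ
    ; conv₂ = λ φ i → conv₂ (tense i) φ
    ; mp    = λ φ ψ f g i → mp (tense i) φ ψ (f i) (g i)
    ; nec□  = λ φ h i → nec□ (tense i) φ (h i)
    ; nec𝐇  = λ φ h i → nec𝐇 (tense i) φ (h i)
    ; us    = λ σ φ h i → us (tense i) σ φ (h i)
    }
    where
    open IsTenseLogic
    tense = λ i → Log-tense (F i)

  -- Canonical models

  -- What is used of a component of the canonical model of `L`. `tight` says that the boxed formulas
  -- determine the order, which later supplies definable upsets.
  record LinearModel (L : Logic) : Set₁ where
    infix 3.5 _≼_ _⊨_
    field
      World   : Set
      _≼_     : World → World → Set
      val     : World → Formula → Bool

    _⊨_ : World → Formula → Set
    w ⊨ φ = T (val w φ)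

    field
      ≼-refl  : ∀ {x} → x ≼ x
      ≼-trans : ∀ {x y z} → x ≼ y → y ≼ z → x ≼ z
      ≼-total : ∀ x y → x ≼ y ⊎ y ≼ x
      ⊨⊥      : ∀ {w} → ¬ w ⊨ ⊥ᶠ
      ⊨⇒      : ∀ {w φ ψ} → w ⊨ φ ⇒ ψ ⇔ (w ⊨ φ → w ⊨ ψ)
      ⊨□      : ∀ {w φ} → w ⊨ □ φ ⇔ (∀ v → w ≼ v → v ⊨ φ)
      ⊨𝐏      : ∀ {w φ} → w ⊨ 𝐏 φ ⇔ (∃ λ v → v ≼ w × v ⊨ φ)
      sound   : ∀ {w φ} → L φ → w ⊨ φ
      tight   : ∀ {w v} → (∀ φ → w ⊨ □ φ → v ⊨ φ) → w ≼ v

  module Canonical {L : Logic} (L-tense : IsTenseLogic L) (S4∙3t⊆L : S4∙3t ⊆ᴸ L) where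
    open IsTenseLogic L-tense

    -- Membership in L lowered to Set, so that the canonical frame lives in Set.
    ⊢_ : Formula → Set
    ⊢ φ = T ⌊ em₁ {L φ} ⌋

    ⊢-intro : ∀ {φ} → L φ → ⊢ φ
    ⊢-intro {φ} = fromWitness {a? = em₁ {L φ}}

    ⊢-elim : ∀ {φ} → ⊢ φ → L φ
    ⊢-elim {φ} = toWitness {a? = em₁ {L φ}}

    record Theory : Set where
      field
        mem      : Formula → Bool
        provable : ∀ {φ} → ⊢ φ → T (mem φ)
        detach   : ∀ {φ ψ} → T (mem (φ ⇒ ψ)) → T (mem φ) → T (mem ψ)

    open Theory

    thm : ∀ Γ {φ} → L φ → T (mem Γ φ)
    thm Γ p = provable Γ (⊢-intro p)

    _∋_ : Theory → Formula → Set
    Γ ∋ φ = T (mem Γ φ)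

    -- By the deduction theorem this is the theory generated by `Γ` and `α`; theories need not be
    -- closed under necessitation.
    add : Theory → Formula → Theory
    add Γ α = record
      { mem    = λ φ → mem Γ (α ⇒ φ)
      ; provable = λ p → thm Γ (mp _ _ (ax1 _ _) (⊢-elim p))
      ; detach = λ h k → detach Γ (detach Γ (thm Γ (ax2 _ _ _)) h) k
      }

    add-⊆ : ∀ Γ {α φ} → Γ ∋ φ → add Γ α ∋ φ
    add-⊆ Γ = detach Γ (thm Γ (ax1 _ _))

    ⇒-refl : ∀ φ → L (φ ⇒ φ)
    ⇒-refl φ = S4∙3t⊆L _ λ F _ V x s → s

    step : Theory → Formula → Theory
    step Γ α with T? (mem Γ (∼ α))
    ... | yes _ = Γ
    ... | no  _ = add Γ α

    step-⊆ : ∀ Γ {α φ} → Γ ∋ φ → step Γ α ∋ φ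
    step-⊆ Γ {α} h with T? (mem Γ (∼ α))
    ... | yes _ = h
    ... | no  _ = add-⊆ Γ h

    step-consistent : ∀ Γ {α} → ¬ Γ ∋ ⊥ᶠ → ¬ step Γ α ∋ ⊥ᶠ
    step-consistent Γ {α} c with T? (mem Γ (∼ α))
    ... | yes _ = c
    ... | no ¬h = ¬h

    step-decides : ∀ Γ α → step Γ α ∋ α ⊎ step Γ α ∋ (∼ α)
    step-decides Γ α with T? (mem Γ (∼ α))
    ... | yes h = inj₂ h
    ... | no _  = inj₁ (thm Γ (⇒-refl α))

    steps : Theory → List Formula → Theory
    steps Γ []      = Γ
    steps Γ (α ∷ l) = steps (step Γ α) l

    steps-⊆ : ∀ Γ l {φ} → Γ ∋ φ → steps Γ l ∋ φ
    steps-⊆ Γ []      h = h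
    steps-⊆ Γ (α ∷ l) h = steps-⊆ (step Γ α) l (step-⊆ Γ h)

    steps-consistent : ∀ Γ l → ¬ Γ ∋ ⊥ᶠ → ¬ steps Γ l ∋ ⊥ᶠ
    steps-consistent Γ []      c = c
    steps-consistent Γ (α ∷ l) c = steps-consistent (step Γ α) l (step-consistent Γ c)

    steps-decides : ∀ Γ {l α} → α ∈ l → steps Γ l ∋ α ⊎ steps Γ l ∋ (∼ α)
    steps-decides Γ {α ∷ l} (here refl) =
      [ inj₁ ∘ steps-⊆ (step Γ α) l , inj₂ ∘ steps-⊆ (step Γ α) l ]′ (step-decides Γ α)
    steps-decides Γ {α ∷ l} (there i) = steps-decides (step Γ α) i

    -- An increasing sequence of finite lists exhausting all formulas takes the place of an
    -- enumeration.
    formulas : ℕ → List Formula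
    formulas zero    = []
    formulas (suc n) = var n ∷ ⊥ᶠ ∷ cartesianProductWith _⇒_ (formulas n) (formulas n)
                       ++ map □ (formulas n) ++ map 𝐏 (formulas n) ++ formulas n

    formulas-suc : ∀ n {φ} → φ ∈ formulas n → φ ∈ formulas (suc n)
    formulas-suc n i = there (there (∈-++⁺ʳ (cartesianProductWith _⇒_ (formulas n) (formulas n))
      (∈-++⁺ʳ (map □ (formulas n)) (∈-++⁺ʳ (map 𝐏 (formulas n)) i))))

    formulas-+ : ∀ m n {φ} → φ ∈ formulas n → φ ∈ formulas (m + n)
    formulas-+ zero    n i = i
    formulas-+ (suc m) n i = formulas-suc (m + n) (formulas-+ m n i)

    ∈-formulas : ∀ φ → ∃ λ n → φ ∈ formulas n
    ∈-formulas (var n) = suc n , here refl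
    ∈-formulas ⊥ᶠ      = 1 , there (here refl)
    ∈-formulas (φ ⇒ ψ) =
      let m , i = ∈-formulas φ
          n , j = ∈-formulas ψ
      in suc (n + m) , there (there (∈-++⁺ˡ (∈-cartesianProductWith⁺ _⇒_ (formulas-+ n m i)
           (transport (λ k → ψ ∈ formulas k) (ℕ.+-comm m n) (formulas-+ m n j)))))
    ∈-formulas (□ φ) =
      let n , i = ∈-formulas φ
      in suc n , there (there (∈-++⁺ʳ (cartesianProductWith _⇒_ (formulas n) (formulas n)) (∈-++⁺ˡ (∈-map⁺ □ i))))
    ∈-formulas (𝐏 φ) =
      let n , i = ∈-formulas φ
      in suc n , there (there (∈-++⁺ʳ (cartesianProductWith _⇒_ (formulas n) (formulas n))
           (∈-++⁺ʳ (map □ (formulas n)) (∈-++⁺ˡ (∈-map⁺ 𝐏 i)))))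

    stage : Theory → ℕ → Theory
    stage Γ zero    = Γ
    stage Γ (suc n) = steps (stage Γ n) (formulas n)

    stage-+ : ∀ Γ m n {φ} → stage Γ n ∋ φ → stage Γ (m + n) ∋ φ
    stage-+ Γ zero    n h = h
    stage-+ Γ (suc m) n h = steps-⊆ (stage Γ (m + n)) (formulas (m + n)) (stage-+ Γ m n h)

    stage-consistent : ∀ Γ n → ¬ Γ ∋ ⊥ᶠ → ¬ stage Γ n ∋ ⊥ᶠ
    stage-consistent Γ zero    c = c
    stage-consistent Γ (suc n) c = steps-consistent (stage Γ n) (formulas n) (stage-consistent Γ n c)

    record MaximalTheory : Set where
      field
        holds      : Formula → Bool
        theorem    : ∀ {φ} → ⊢ φ → T (holds φ)
        ponens     : ∀ {φ ψ} → T (holds (φ ⇒ ψ)) → T (holds φ) → T (holds ψ)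
        consistent : ¬ T (holds ⊥ᶠ)
        complete   : ∀ φ → T (holds φ) ⊎ T (holds (∼ φ))

    -- The union of the stages works: stage `suc n` decides all of `formulas n`, and an
    -- inconsistency would already occur at a finite stage.
    lindenbaum : ∀ Γ → ¬ Γ ∋ ⊥ᶠ → Σ MaximalTheory λ Δ → ∀ {φ} → Γ ∋ φ → T (MaximalTheory.holds Δ φ)
    lindenbaum Γ c = Δ , λ h → limit-in (0 , h)
      where
      Limit : Formula → Set
      Limit φ = ∃ λ n → stage Γ n ∋ φ
      limit-in : ∀ {φ} → Limit φ → T (char Limit φ)
      limit-in = from (char⇔ Limit _)
      limit-out : ∀ {φ} → T (char Limit φ) → Limit φ
      limit-out = to (char⇔ Limit _)
      Δ : MaximalTheory
      Δ = record
        { holds      = char Limit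
        ; theorem    = λ p → limit-in (0 , provable Γ p)
        ; ponens     = λ h k → limit-in (ponens (limit-out h) (limit-out k))
        ; consistent = λ h → let n , k = limit-out h in stage-consistent Γ n c k
        ; complete   = λ φ → let n , i = ∈-formulas φ in
            [ (λ h → inj₁ (limit-in (suc n , h))) , (λ h → inj₂ (limit-in (suc n , h))) ]′
              (steps-decides (stage Γ n) i)
        }
        where
        ponens : ∀ {φ ψ} → Limit (φ ⇒ ψ) → Limit φ → Limit ψ
        ponens {φ} {ψ} (m , h) (n , k) = n + m ,
          detach (stage Γ (n + m)) (stage-+ Γ n m h)
            (transport (λ l → stage Γ l ∋ φ) (ℕ.+-comm m n) (stage-+ Γ m n k))

    open MaximalTheory hiding (theorem)

    theorem : ∀ Γ {φ} → L φ → T (holds Γ φ)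
    theorem Γ p = MaximalTheory.theorem Γ (⊢-intro p)

    infix 3.5 _⊩_ _≤ᶜ_
    _⊩_ : MaximalTheory → Formula → Set
    Γ ⊩ φ = T (holds Γ φ)

    record _≤ᶜ_ (Γ Δ : MaximalTheory) : Set where
      constructor ≤-intro
      field □-elim : ∀ {φ} → Γ ⊩ □ φ → Δ ⊩ φ
    open _≤ᶜ_

    ⊩⇒ : ∀ Γ {φ ψ} → Γ ⊩ φ ⇒ ψ ⇔ (Γ ⊩ φ → Γ ⊩ ψ)
    ⊩⇒ Γ {φ} {ψ} = mk⇔ (ponens Γ) back
      where
      back : (Γ ⊩ φ → Γ ⊩ ψ) → Γ ⊩ φ ⇒ ψ
      back f with complete Γ φ
      ... | inj₁ h = ponens Γ (theorem Γ (ax1 _ _)) (f h)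
      ... | inj₂ h = ponens Γ (theorem Γ (S4∙3t⊆L _ λ F _ V x n s → ⊥-elim (n s))) h

    ⊩∼ : ∀ Γ {φ} → ¬ Γ ⊩ φ → Γ ⊩ ∼ φ
    ⊩∼ Γ {φ} n = [ (λ h → contradiction h n) , id ]′ (complete Γ φ)

    ⊩-by : ∀ Γ {φ ψ} → S4∙3t (φ ⇒ ψ) → Γ ⊩ φ → Γ ⊩ ψ
    ⊩-by Γ p = ponens Γ (theorem Γ (S4∙3t⊆L _ p))

    ⊩-absurd : ∀ Γ {φ} → Γ ⊩ ∼ φ → ¬ Γ ⊩ φ
    ⊩-absurd Γ n h = consistent Γ (ponens Γ n h)

    □⁻¹ : MaximalTheory → Theory
    □⁻¹ Γ = record
      { mem    = λ φ → holds Γ (□ φ)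
      ; provable = λ p → theorem Γ (nec□ _ (⊢-elim p))
      ; detach = λ h k → ponens Γ (ponens Γ (theorem Γ (K□ _ _)) h) k }

    𝐇⁻¹ : MaximalTheory → Theory
    𝐇⁻¹ Γ = record
      { mem    = λ φ → holds Γ (𝐇 φ)
      ; provable = λ p → theorem Γ (nec𝐇 _ (⊢-elim p))
      ; detach = λ h k → ponens Γ (ponens Γ (theorem Γ (K𝐇 _ _)) h) k }

    ⊩□ : ∀ Γ {φ} → Γ ⊩ □ φ ⇔ (∀ Δ → Γ ≤ᶜ Δ → Δ ⊩ φ)
    ⊩□ Γ {φ} = mk⇔ (λ h Δ r → □-elim r h) λ f → dne λ n →
      let Δ , sub = lindenbaum (add (□⁻¹ Γ) (∼ φ))
                      (λ b → n (⊩-by Γ (λ F _ V x s y r → dne (s y r)) b))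
      in ⊩-absurd Δ (sub (theorem Γ (nec□ _ (⇒-refl _)))) (f Δ (≤-intro λ h → sub (add-⊆ (□⁻¹ Γ) h)))

    -- The axiom `conv₂` ties `𝐇` to the converse of `≤ᶜ`: if `□ χ` is in `Δ` but `χ` is not in `Γ`,
    -- then `𝐇 (◇ (∼ χ))` is in `Γ`, hence `◇ (∼ χ)` is in `Δ`, a contradiction.
    𝐇-≤ : ∀ Γ Δ → (∀ χ → Γ ⊩ 𝐇 χ → Δ ⊩ χ) → Δ ≤ᶜ Γ
    𝐇-≤ Γ Δ h = ≤-intro λ {χ} k → dne λ n → ⊩-absurd Δ
      (h (◇ (∼ χ)) (ponens Γ (theorem Γ (conv₂ _)) (⊩∼ Γ n)))
      (⊩-by Δ (λ F _ V x s y r n → n (s y r)) k)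

    ⊩𝐏 : ∀ Γ {φ} → Γ ⊩ 𝐏 φ ⇔ (∃ λ Δ → Δ ≤ᶜ Γ × Δ ⊩ φ)
    ⊩𝐏 Γ {φ} = mk⇔ forth λ (Δ , r , h) → □-elim r (ponens Δ (theorem Δ (conv₁ _)) h)
      where
      forth : Γ ⊩ 𝐏 φ → ∃ λ Δ → Δ ≤ᶜ Γ × Δ ⊩ φ
      forth h =
        let Δ , sub = lindenbaum (add (𝐇⁻¹ Γ) φ)
              (λ b → ⊩-absurd Γ b (⊩-by Γ (λ F _ V x (y , r , s) → y , r , λ n → n s) h))
        in Δ , 𝐇-≤ Γ Δ (λ χ k → sub (add-⊆ (𝐇⁻¹ Γ) k)) , sub (theorem Γ (nec𝐇 _ (⇒-refl _)))

    𝐇-elim : ∀ {Γ Δ φ} → Δ ≤ᶜ Γ → Γ ⊩ 𝐇 φ → Δ ⊩ φ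
    𝐇-elim {Γ} {Δ} {φ} r h = dne λ n → ⊩-absurd Γ h (from (⊩𝐏 Γ) (Δ , r , ⊩∼ Δ n))

    ≤ᶜ-refl : ∀ Γ → Γ ≤ᶜ Γ
    ≤ᶜ-refl Γ = ≤-intro (⊩-by Γ λ F (rf , _) V x s → s x (rf x))

    ≤ᶜ-trans : ∀ {Γ Δ Ε} → Γ ≤ᶜ Δ → Δ ≤ᶜ Ε → Γ ≤ᶜ Ε
    ≤ᶜ-trans {Γ} r s = ≤-intro λ h →
      □-elim s (□-elim r (⊩-by Γ (λ F (_ , tr , _) V x k y p z q → k z (tr x y z p q)) h))

    Comparable : MaximalTheory → MaximalTheory → Set
    Comparable Γ Δ = Γ ≤ᶜ Δ ⊎ Δ ≤ᶜ Γ

    private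
      -- Incomparability yields `χ` and `θ` such that `Δ` contains `□ χ` but not `θ`, and `Ε`
      -- contains `□ θ` but not `χ`. This clashes with the linearity schema, whose future and past
      -- forms give the next two lemmas.
      comparable : ∀ Δ Ε →
        (∀ {χ θ} → ¬ Δ ⊩ (□ χ ⇒ θ) → ¬ ¬ Ε ⊩ (□ θ ⇒ χ)) → Comparable Δ Ε
      comparable Δ Ε h with em₀ {Δ ≤ᶜ Ε} | em₀ {Ε ≤ᶜ Δ}
      ... | yes r | _ = inj₁ r
      ... | _ | yes r = inj₂ r
      ... | no ¬r | no ¬s =
        let χ , p , q = ¬∀⇒∃¬ λ f → ¬r (≤-intro λ {φ} → f φ)
            θ , p′ , q′ = ¬∀⇒∃¬ λ f → ¬s (≤-intro λ {φ} → f φ)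
        in ⊥-elim (h {χ} {θ} (λ k → q′ (ponens Δ k p)) (λ k → q (ponens Ε k p′)))

    above-comparable : ∀ {Γ Δ Ε} → Γ ≤ᶜ Δ → Γ ≤ᶜ Ε → Comparable Δ Ε
    above-comparable {Γ} {Δ} {Ε} r s = comparable Δ Ε λ {χ} {θ} n n′ →
      n′ (□-elim s (⊩-by Γ (valid χ θ) (⊩∼ Γ (n ∘ □-elim r))))
      where
      valid : ∀ χ θ → S4∙3t (∼ □ (□ χ ⇒ θ) ⇒ □ (□ θ ⇒ χ))
      valid χ θ F (_ , _ , total) V x n z p k = dne λ ¬χ → n λ y q h →
        [ (λ t → contradiction (h z t) ¬χ) , k y ]′ (total y z)

    below-comparable : ∀ {Γ Δ Ε} → Δ ≤ᶜ Γ → Ε ≤ᶜ Γ → Comparable Δ Ε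
    below-comparable {Γ} {Δ} {Ε} r s = comparable Δ Ε λ {χ} {θ} n n′ →
      n′ (𝐇-elim s (⊩-by Γ (valid χ θ) (⊩∼ Γ (n ∘ 𝐇-elim r))))
      where
      valid : ∀ χ θ → S4∙3t (∼ 𝐇 (□ χ ⇒ θ) ⇒ 𝐇 (□ θ ⇒ χ))
      valid χ θ F (_ , _ , total) V x n (z , p , ¬k) = n λ (y , q , ¬h) → ¬k λ k →
        ⊥-elim (¬h λ h → [ (λ t → ⊥-elim (¬k λ _ → h z t)) , k y ]′ (total y z))

    -- Restricting to the theories comparable with `Γ` keeps all successors and predecessors, and
    -- the two comparability lemmas make the order total.
    component : MaximalTheory → LinearModel L
    component Γ = record
      { World   = Σ MaximalTheory (Comparable Γ)
      ; _≼_     = λ (Δ , _) (Ε , _) → Δ ≤ᶜ Ε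
      ; val     = λ (Δ , _) → holds Δ
      ; ≼-refl  = ≤ᶜ-refl _
      ; ≼-trans = ≤ᶜ-trans
      ; ≼-total = λ (_ , c) (_ , d) → linear c d
      ; ⊨⊥      = λ {(Δ , _)} → consistent Δ
      ; ⊨⇒      = λ {(Δ , _)} → ⊩⇒ Δ
      ; ⊨□      = λ {(Δ , c)} → mk⇔ (λ h (Ε , _) r → □-elim r h)
                    (λ f → from (⊩□ Δ) λ Ε r → f (Ε , up c r) r)
      ; ⊨𝐏      = λ {(Δ , c)} → mk⇔ (λ h → let Ε , r , k = to (⊩𝐏 Δ) h in (Ε , down c r) , r , k)
                    (λ ((Ε , _) , r , k) → from (⊩𝐏 Δ) (Ε , r , k))
      ; sound   = λ {(Δ , _)} → theorem Δ
      ; tight   = λ h → ≤-intro λ {φ} → h φ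
      }
      where
      linear : ∀ {Δ Ε} → Comparable Γ Δ → Comparable Γ Ε → Comparable Δ Ε
      linear (inj₁ r) (inj₁ s) = above-comparable r s
      linear (inj₁ r) (inj₂ s) = inj₂ (≤ᶜ-trans s r)
      linear (inj₂ r) (inj₁ s) = inj₁ (≤ᶜ-trans r s)
      linear (inj₂ r) (inj₂ s) = below-comparable r s
      up : ∀ {Δ Ε} → Comparable Γ Δ → Δ ≤ᶜ Ε → Comparable Γ Ε
      up (inj₁ r) s = inj₁ (≤ᶜ-trans r s)
      up (inj₂ r) s = above-comparable r s
      down : ∀ {Δ Ε} → Comparable Γ Δ → Ε ≤ᶜ Δ → Comparable Γ Ε
      down (inj₁ r) s = below-comparable r s
      down (inj₂ r) s = inj₂ (≤ᶜ-trans s r)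

    Countermodel : Formula → Set₁
    Countermodel φ = Σ (LinearModel L) λ M → ∃ λ w → ¬ LinearModel._⊨_ M w φ

    countermodel : ∀ {φ} → ¬ L φ → Countermodel φ
    countermodel {φ} n = component Γ , (Γ , inj₁ (≤ᶜ-refl Γ)) , ⊩-absurd Γ (sub (⊢-intro (⇒-refl _)))
      where
      Λ : Theory
      Λ = record
        { mem      = λ χ → ⌊ em₁ {L χ} ⌋
        ; provable = id
        ; detach   = λ h k → ⊢-intro (mp _ _ (⊢-elim h) (⊢-elim k)) }
      Lind : Σ MaximalTheory λ Δ → ∀ {ψ} → add Λ (∼ φ) ∋ ψ → Δ ⊩ ψ
      Lind = lindenbaum (add Λ (∼ φ)) λ b → n (mp _ _ (ax3 φ) (⊢-elim b))
      Γ   = proj₁ Lind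
      sub = proj₂ Lind

  -- Definable maps

  -- A finite decision tree over formulas encodes a map from worlds to `A` with finitely many
  -- values, for which the preimage of every subset of `A` is defined by a formula.
  data Tree (A : Set) : Set where
    leaf : A → Tree A
    node : Formula → Tree A → Tree A → Tree A

  mapTree : {A B : Set} → (A → B) → Tree A → Tree B
  mapTree f (leaf a)     = leaf (f a)
  mapTree f (node φ d e) = node φ (mapTree f d) (mapTree f e)

  cond : Formula → Formula → Formula → Formula
  cond φ α β = ∼ ((φ ⇒ α) ⇒ ∼ (∼ φ ⇒ β))

  preimage : {A : Set} → (A → Set) → Tree A → Formula
  preimage P (leaf a)     = if ⌊ em₀ {P a} ⌋ then ⊥ᶠ ⇒ ⊥ᶠ else ⊥ᶠ
  preimage P (node φ d e) = cond φ (preimage P d) (preimage P e)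

  module InModel {L : Logic} (M : LinearModel L) where
    open LinearModel M public

    frame : Frame
    frame = record { W = World ; R = _≼_ }

    ⊨∼ : ∀ {w φ} → w ⊨ ∼ φ ⇔ (¬ w ⊨ φ)
    ⊨∼ = mk⇔ (λ h k → ⊨⊥ (to ⊨⇒ h k)) (λ n → from ⊨⇒ (⊥-elim ∘ n))

    truth : ∀ σ φ {w} → sat frame (λ p v → v ⊨ σ p) w φ ⇔ w ⊨ subst σ φ
    truth σ (var p) = ⇔-id _
    truth σ ⊥ᶠ      = mk⇔ ⊥-elim ⊨⊥
    truth σ (φ ⇒ ψ) = mk⇔
      (λ h → from ⊨⇒ λ k → to (truth σ ψ) (h (from (truth σ φ) k)))
      (λ h k → from (truth σ ψ) (to ⊨⇒ h (to (truth σ φ) k)))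
    truth σ (□ φ) = mk⇔
      (λ h → from ⊨□ λ v r → to (truth σ φ) (h v r))
      (λ h v r → from (truth σ φ) (to ⊨□ h v r))
    truth σ (𝐏 φ) = mk⇔
      (λ (v , r , h) → from ⊨𝐏 (v , r , to (truth σ φ) h))
      (λ h → let v , r , k = to ⊨𝐏 h in v , r , from (truth σ φ) k)

    eval : {A : Set} → Tree A → World → A
    eval (leaf a)     w = a
    eval (node φ d e) w = if val w φ then eval d w else eval e w

    eval-yes : ∀ {A φ} (d e : Tree A) {w} → w ⊨ φ → eval (node φ d e) w ≡ eval d w
    eval-yes {φ = φ} d e {w} h with true ← val w φ = refl

    eval-no : ∀ {A φ} (d e : Tree A) {w} → ¬ w ⊨ φ → eval (node φ d e) w ≡ eval e w
    eval-no {φ = φ} d e {w} n with val w φ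
    ... | true  = contradiction tt n
    ... | false = refl

    eval-map : ∀ {A B} (f : A → B) d {w} → eval (mapTree f d) w ≡ f (eval d w)
    eval-map f (leaf a) = refl
    eval-map f (node φ d e) {w} with val w φ
    ... | true  = eval-map f d
    ... | false = eval-map f e

    ⊨cond-yes : ∀ {w φ α β} → w ⊨ φ → w ⊨ cond φ α β ⇔ w ⊨ α
    ⊨cond-yes h = mk⇔
      (λ k → dne λ n → to ⊨∼ k (from ⊨⇒ λ f → contradiction (to ⊨⇒ f h) n))
      (λ a → from ⊨∼ λ f → to ⊨∼ (to ⊨⇒ f (from ⊨⇒ λ _ → a)) (from ⊨⇒ λ n → contradiction h (to ⊨∼ n)))

    ⊨cond-no : ∀ {w φ α β} → ¬ w ⊨ φ → w ⊨ cond φ α β ⇔ w ⊨ β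
    ⊨cond-no h = mk⇔
      (λ k → dne λ n → to ⊨∼ k (from ⊨⇒ λ _ → from ⊨∼ λ f → n (to ⊨⇒ f (from ⊨∼ h))))
      (λ b → from ⊨∼ λ f → to ⊨∼ (to ⊨⇒ f (from ⊨⇒ λ k → contradiction k h)) (from ⊨⇒ λ _ → b))

    ⊨preimage : {A : Set} (P : A → Set) (d : Tree A) {w : World} → w ⊨ preimage P d ⇔ P (eval d w)
    ⊨preimage P (leaf a) with em₀ {P a}
    ... | yes p = mk⇔ (λ _ → p) (λ _ → from ⊨⇒ id)
    ... | no ¬p = mk⇔ (⊥-elim ∘ ⊨⊥) (⊥-elim ∘ ¬p)
    ⊨preimage P (node φ d e) {w} with T? (val w φ)
    ... | yes h =
      transport (λ a → w ⊨ preimage P d ⇔ P a) (sym (eval-yes d e h)) (⊨preimage P d) ⇔-∘ ⊨cond-yes h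
    ... | no ¬h =
      transport (λ a → w ⊨ preimage P e ⇔ P a) (sym (eval-no d e ¬h)) (⊨preimage P e) ⇔-∘ ⊨cond-no ¬h

    module _ (L-tense : IsTenseLogic L) {G : Frame} (rtl : RTL G) {V : Valuation G} (d : Tree (W G)) where

      -- By closure under substitution, theorems of `L` hold in `M` under every valuation given by
      -- formulas. Pulling `V` back along a decision tree gives such a valuation, and the
      -- bisimulation carries the truth of `φ` over to `G`.
      definable-image : ∀ φ → let _~_ = Similar G V (varBound φ) in
        (∀ {w v} → w ≼ v → R G (eval d w) (eval d v)) →
        (∀ g → ∃ λ w → eval d w ~ g) →
        (∀ w g → R G (eval d w) g → R G g (eval d w) → ∃ λ v → w ≼ v × v ≼ w × eval d v ~ g) →
        L φ → ∀ g → sat G V g φ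
      definable-image φ mono surj same h g =
        let w , e = surj g in
        to (sat-bisim (monotone-bisim ≼-total rtl (eval d) (λ {w} {p} → ⊨preimage (V p) d) mono surj same)
              φ (below φ ℕ.≤-refl) e)
           (from (truth _ φ) (sound (IsTenseLogic.us L-tense _ φ h)))

    -- Order and apartness of points

    infix 3.5 _≺_
    _≺_ : World → World → Set
    x ≺ y = x ≼ y × ¬ y ≼ x

    ⋠⇒≺ : ∀ {x y} → ¬ x ≼ y → y ≺ x
    ⋠⇒≺ {x} {y} n = [ (λ r → contradiction r n) , (λ r → r , n) ]′ (≼-total x y)

    -- Tightness gives `χ` with `□ χ` true at `x` and `χ` false at `y`; by reflexivity `□ χ` itself
    -- fails at `y`, and its truth set is an upset.
    separate : ∀ {x y} → ¬ x ≼ y → ∃ λ χ → x ⊨ □ χ × ¬ y ⊨ □ χ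
    separate n = let χ , h , k = ¬∀⇒∃¬ (n ∘ tight) in χ , h , λ b → k (to ⊨□ b _ ≼-refl)

    persist : ∀ {x y χ} → x ≼ y → x ⊨ □ χ → y ⊨ □ χ
    persist r h = from ⊨□ λ v s → to ⊨□ h v (≼-trans r s)

    Apart : World → World → Set
    Apart x y = ∃ λ φ → x ⊨ φ × ¬ y ⊨ φ

    ¬Apart-⊨ : ∀ {x y} → ¬ Apart x y → ∀ φ → x ⊨ φ ⇔ y ⊨ φ
    ¬Apart-⊨ n φ = mk⇔ (λ h → dne λ k → n (φ , h , k))
                       (λ h → dne λ k → n (∼ φ , from ⊨∼ k , λ l → to ⊨∼ l h))

    apart-all : ∀ {x l} → All (Apart x) l → ∃ λ φ → x ⊨ φ × All (λ y → ¬ y ⊨ φ) l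
    apart-all [] = (⊥ᶠ ⇒ ⊥ᶠ) , from ⊨⇒ id , []
    apart-all {l = y ∷ l} ((φ , h , n) ∷ p) =
      let ψ , k , ns = apart-all p in
      ∼ (φ ⇒ ∼ ψ) , from ⊨∼ (λ f → to ⊨∼ (to ⊨⇒ f h) k) ,
      (λ f → to ⊨∼ f (from ⊨⇒ λ k → contradiction k n)) ∷
      All.map (λ n f → to ⊨∼ f (from ⊨⇒ λ _ → from ⊨∼ n)) ns

    interpolate : ∀ {A l} → AllPairs Apart l → A → (a : Fin (length l) → A) →
                  ∃ λ d → ∀ i → eval d (lookup l i) ≡ a i
    interpolate [] z a = leaf z , λ ()
    interpolate {l = x ∷ l} (p ∷ ps) z a =
      let φ , h , ns = apart-all p
          d , e      = interpolate ps z (a ∘ Fin.suc)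
      in node φ (leaf (a Fin.zero)) d , λ
           { Fin.zero    → eval-yes (leaf (a Fin.zero)) d h
           ; (Fin.suc i) → trans (eval-no (leaf (a Fin.zero)) d (All.lookup ns (∈-lookup i))) (e i) }

    -- Depth

    -- Strict steps are counted, so `Depth> n x` provides `n + 1` clusters and is always true for
    -- `n = 0`.
    Depth> : ℕ → World → Set
    Depth> zero    x = ⊤
    Depth> (suc n) x = ∃ λ y → x ≺ y × Depth> n y

    ChainMap : ℕ → World → Set
    ChainMap n x = Σ (Tree (Fin (suc n))) λ d →
      (∀ {w v} → w ≼ v → toℕ (eval d v) ≤ toℕ (eval d w)) ×
      (∀ i → ∃ λ w → x ≼ w × eval d w ≡ i)

    -- A formula `□ χ` true at `y` and false at `x` splits off a new layer: worlds satisfying it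
    -- keep their value, and all others go to the new largest index, which is the bottom of the
    -- longer chain.
    chainMap : ∀ n x → Depth> n x → ChainMap n x
    chainMap zero x _ = leaf Fin.zero , (λ _ → z≤n) , λ { Fin.zero → x , ≼-refl , refl }
    chainMap (suc n) x (y , (x≼y , y⋠x) , c) =
      let d , mono , surj = chainMap n y c
          χ , h , k       = separate y⋠x
      in extend d mono surj χ h k
      where
      extend : (d : Tree (Fin (suc n))) → (∀ {w v} → w ≼ v → toℕ (eval d v) ≤ toℕ (eval d w)) →
               (∀ i → ∃ λ w → y ≼ w × eval d w ≡ i) →
               ∀ χ → y ⊨ □ χ → ¬ x ⊨ □ χ → ChainMap (suc n) x
      extend d mono surj χ h k = e , emono , esurj
        where
        low top e : Tree (Fin (suc (suc n)))
        low = mapTree inject₁ d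
        top = leaf (fromℕ (suc n))
        e = node (□ χ) low top
        eval-e : ∀ {w} → w ⊨ □ χ → eval e w ≡ inject₁ (eval d w)
        eval-e l = trans (eval-yes low top l) (eval-map inject₁ d)
        emono : ∀ {w v} → w ≼ v → toℕ (eval e v) ≤ toℕ (eval e w)
        emono {w} {v} r with T? (val w (□ χ))
        ... | yes l rewrite eval-e l | eval-e (persist r l)
                          | Fin.toℕ-inject₁ (eval d w) | Fin.toℕ-inject₁ (eval d v) = mono r
        ... | no ¬l rewrite eval-no {φ = □ χ} low top ¬l
                          | Fin.toℕ-fromℕ n = Fin.toℕ≤pred[n] (eval e v)
        esurj : ∀ i → ∃ λ w → x ≼ w × eval e w ≡ i
        esurj i with view i
        ... | ‵fromℕ = x , ≼-refl , eval-no low top k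
        ... | ‵inj₁ {i = j} _ =
          let w , r , q = surj j in w , ≼-trans x≼y r , trans (eval-e (persist r h)) (cong inject₁ q)

    chain-sound : IsTenseLogic L → ∀ {n x} → Depth> n x → L ⊆ᴸ Log (Chain (suc n))
    chain-sound L-tense {n} {x} c φ h V g =
      let d , mono , surj = chainMap n x c
      in definable-image L-tense rtl {V = V} d φ mono
           (λ g → let w , _ , e = surj g in w , ≡⇒Similar rtl V e)
           (λ w g r s → w , ≼-refl , ≼-refl , ≡⇒Similar rtl V (Fin.toℕ-injective (ℕ.≤-antisym s r))) h g
      where
      rtl : RTL (Chain (suc n))
      rtl = Chain-RTL (suc n)

    -- A member of `S` of maximal depth is least: a member strictly below it would be one step
    -- deeper.
    least : (S : World → Set) → ∀ n → (∀ {x} → S x → ¬ Depth> n x) → ∃ S → ∃ λ x → S x × (∀ {z} → S z → x ≼ z)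
    least S zero    b (x , s) = contradiction tt (b s)
    least S (suc n) b ne with em₀ {∃ λ x → S x × Depth> n x}
    ... | yes (x , s , c) = x , s , λ {z} t → dne λ n → b t (x , ⋠⇒≺ n , c)
    ... | no k            = least S n (λ s c → k (_ , s , c)) ne

    -- Dually, a member of minimal depth is greatest. One member of bounded depth is enough, since
    -- the search only moves to members of smaller depth.
    greatest : (S : World → Set) → ∀ n {x} → S x → ¬ Depth> n x → ∃ λ x → S x × (∀ {z} → S z → z ≼ x)
    greatest S zero    s b = contradiction tt b
    greatest S (suc n) {x} s b with em₀ {∃ λ y → S y × ¬ Depth> n y}
    ... | yes (y , t , c) = greatest S n t c
    ... | no k = x , s , λ {z} t → dne λ n → b (z , ⋠⇒≺ n , dne λ c → k (z , t , c))

    list-min : ∀ x l → ∃ λ y → y ∈ x ∷ l × All (y ≼_) (x ∷ l)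
    list-min x [] = x , here refl , ≼-refl ∷ []
    list-min x (x′ ∷ l) with list-min x′ l
    ... | y , i , m with ≼-total x y
    ...   | inj₁ r = x , here refl , ≼-refl ∷ All.map (≼-trans r) m
    ...   | inj₂ r = y , there i , r ∷ m

    -- Clusters are measured by pairwise separated worlds, hence up to modal equivalence.
    SmallClusters : ℕ → Set
    SmallClusters m = ∀ x l → AllPairs Apart l → All (x ≼_) l → All (_≼ x) l → length l ≤ m

    length-split : ∀ {P : World → Set} (P? : ∀ x → Dec (P x)) l →
                   length l ≡ length (filter P? l) + length (filter (¬? ∘ P?) l)
    length-split P? [] = refl
    length-split P? (x ∷ l) with P? x
    ... | yes _ = cong suc (length-split P? l)
    ... | no  _ = trans (cong suc (length-split P? l)) (sym (ℕ.+-suc _ _))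

    -- Peel off the lowest cluster: the listed worlds that see back to or lie in the cluster of the
    -- minimum `y` number at most `m`. The others lie strictly above `y`, so their depth bound drops
    -- by one.
    points-bounded : ∀ {m} → SmallClusters m → ∀ n l → AllPairs Apart l → All (¬_ ∘ Depth> n) l → length l ≤ n * m
    points-bounded small n [] ps b = z≤n
    points-bounded small zero (x ∷ l) ps (b ∷ _) = contradiction tt b
    points-bounded {m} small (suc n) (x ∷ l) ps b = go (list-min x l)
      where
      go : (∃ λ y → y ∈ x ∷ l × All (y ≼_) (x ∷ l)) → length (x ∷ l) ≤ suc n * m
      go (y , i , above) = transport (_≤ suc n * m) (sym (length-split P? (x ∷ l)))
        (ℕ.+-mono-≤
          (small y (filter P? (x ∷ l)) (AllPairs.filter⁺ P? ps) (All.filter⁺ P? above) (All.all-filter P? (x ∷ l)))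
          (points-bounded small n (filter (¬? ∘ P?) (x ∷ l)) (AllPairs.filter⁺ (¬? ∘ P?) ps)
            (All.map (λ n c → All.lookup b i (_ , ⋠⇒≺ n , c)) (All.all-filter (¬? ∘ P?) (x ∷ l)))))
        where
        P? : ∀ z → Dec (z ≼ y)
        P? z = em₀

    -- Clusters

    module _ {n} (bounded : ∀ x → ¬ Depth> n x) (x : World) where

      -- By bounded depth there is a least world strictly above `x`, unless there is none at all; a
      -- boxed formula true there and false at `x` defines the set.
      strictly-above : ∃ λ φ → ∀ {w} → w ⊨ φ ⇔ x ≺ w
      strictly-above with em₀ {∃ (x ≺_)}
      ... | no k = ⊥ᶠ , mk⇔ (⊥-elim ∘ ⊨⊥) (λ s → ⊥-elim (k (_ , s)))
      ... | yes ne =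
        let y , (_ , n) , min = least (x ≺_) _ (λ _ → bounded _) ne
            χ , h , k = separate n
        in □ χ , mk⇔ (λ l → ⋠⇒≺ λ r → k (persist r l)) (λ s → persist (min s) h)

      -- Here the boxed formula separates `x` from the greatest world strictly below it.
      weakly-above : ∃ λ φ → ∀ {w} → w ⊨ φ ⇔ x ≼ w
      weakly-above with em₀ {∃ (_≺ x)}
      ... | no k = (⊥ᶠ ⇒ ⊥ᶠ) , mk⇔ (λ _ → dne λ n → k (_ , ⋠⇒≺ n)) (λ _ → from ⊨⇒ id)
      ... | yes (y , s) =
        let z , (_ , n) , max = greatest (_≺ x) _ s (bounded y)
            χ , h , k = separate n
        in □ χ , mk⇔ (λ l → dne λ n → k (persist (max (⋠⇒≺ n)) l)) (λ r → persist r h)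

      data Place (w : World) : Set where
        above  : x ≺ w → Place w
        inside : x ≼ w → w ≼ x → Place w
        under  : w ≺ x → Place w

      place : ∀ w → Place w
      place w with em₀ {x ≼ w} | em₀ {w ≼ x}
      ... | no n  | _     = under (⋠⇒≺ n)
      ... | yes r | yes s = inside r s
      ... | yes r | no n  = above (r , n)

      level : ∀ {w} → Place w → ℕ
      level (above _)    = 2
      level (inside _ _) = 1
      level (under _)    = 0

      level-mono : ∀ {w v} (p : Place w) (q : Place v) → w ≼ v → level p ≤ level q
      level-mono (under _)    _             t = z≤n
      level-mono (inside r _) (above _)     t = s≤s z≤n
      level-mono (inside r _) (inside _ _)  t = s≤s z≤n
      level-mono (inside r _) (under s)     t = contradiction (≼-trans r t) (proj₂ s)
      level-mono (above _)    (above _)     t = s≤s (s≤s z≤n)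
      level-mono (above r)    (inside _ s)  t = contradiction (≼-trans t s) (proj₂ r)
      level-mono (above r)    (under s)     t = contradiction (≼-trans t (proj₁ s)) (proj₂ r)

      module _ (L-tense : IsTenseLogic L) {l : List World} (ps : AllPairs Apart l)
               (l-above : All (x ≼_) l) (l-below : All (_≼ x) l)
               {G : Frame} {c : ℕ → W G} (C : ClusterFrame G c (∃ (x ≺_)) (∃ (_≺ x))) where
        open ClusterFrame C

        -- Worlds above and below the cluster of `x` collapse to `hi` and `lo`, and the worlds of
        -- `l` are sent onto representatives of all types of cluster points in the variables of `φ`.
        -- So a finite `l` suffices even when the cluster of `G` is infinite.
        cluster-sound : ∀ φ V reps →
          (∀ k → Any (λ r → ∀ p → p < varBound φ → V p (c k) ⇔ V p (c r)) reps) →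
          length reps ≤ length l → L φ → ∀ g → sat G V g φ
        cluster-sound φ V reps covers long =
          definable-image L-tense rtl {V = V} d φ
            (λ {w} {v} r → from R⇔ (transport₂ _≤_ (sym (rk-level (place w))) (sym (rk-level (place v)))
                                      (level-mono (place w) (place v) r)))
            (λ g → surj g (cover g))
            (λ w g r s → same (place w) (cover g)
               (trans (sym (rk-level (place w))) (ℕ.≤-antisym (to R⇔ r) (to R⇔ s))))
          where
          rtl : RTL G
          rtl = (λ _ → from R⇔ ℕ.≤-refl) , (λ _ _ _ r s → from R⇔ (ℕ.≤-trans (to R⇔ r) (to R⇔ s))) ,
                λ g h → [ inj₁ ∘ from R⇔ , inj₂ ∘ from R⇔ ]′ (ℕ.≤-total (rk g) (rk h))

          -- Surplus worlds of `l` get the default of `nth` and land on `c 0`. Worlds of the cluster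
          -- outside `l` land on some `c k`, which is all that monotonicity needs.
          inner = interpolate ps 0 (λ i → nth reps (toℕ i))
          e = proj₁ inner

          d₁ d : Tree (W G)
          d₁ = node (proj₁ weakly-above) (mapTree c e) (leaf lo)
          d  = node (proj₁ strictly-above) (leaf hi) d₁

          eval-above : ∀ {w} → x ≺ w → eval d w ≡ hi
          eval-above s = eval-yes (leaf hi) d₁ (from (proj₂ strictly-above) s)

          eval-inside : ∀ {w} → x ≼ w → w ≼ x → eval d w ≡ c (eval e w)
          eval-inside r s =
            trans (eval-no (leaf hi) d₁ (λ h → proj₂ (to (proj₂ strictly-above) h) s))
            (trans (eval-yes (mapTree c e) (leaf lo) (from (proj₂ weakly-above) r)) (eval-map c e))

          eval-under : ∀ {w} → w ≺ x → eval d w ≡ lo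
          eval-under (r , n) =
            trans (eval-no (leaf hi) d₁ (λ h → n (proj₁ (to (proj₂ strictly-above) h))))
                  (eval-no (mapTree c e) (leaf lo) (λ h → n (to (proj₂ weakly-above) h)))

          rk-level : ∀ {w} (p : Place w) → rk (eval d w) ≡ level p
          rk-level (above s)    = trans (cong rk (eval-above s)) (rk-hi (_ , s))
          rk-level (inside r s) = trans (cong rk (eval-inside r s)) (rk-c _)
          rk-level (under s)    = trans (cong rk (eval-under s)) (rk-lo (_ , s))

          hit : ∀ k → ∃ λ v → x ≼ v × v ≼ x × Similar G V (varBound φ) (eval d v) (c k)
          hit k =
            let i , i<m , agree = nth-Any (covers k)
                j = Fin.fromℕ< (ℕ.≤-trans i<m long)
                v = lookup l j
                r = All.lookup l-above (∈-lookup j)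
                s = All.lookup l-below (∈-lookup j)
                eq : eval d v ≡ c (nth reps i)
                eq = trans (eval-inside r s) (cong c (trans (proj₂ inner j) (cong (nth reps) (Fin.toℕ-fromℕ< _))))
            in v , r , s , transport (λ g → Similar G V (varBound φ) g (c k)) (sym eq)
                 (from R⇔ (ℕ.≤-reflexive (trans (rk-c _) (sym (rk-c _)))) ,
                  from R⇔ (ℕ.≤-reflexive (trans (rk-c _) (sym (rk-c _)))) ,
                  λ p p<K → ⇔-sym (agree p p<K))

          surj : ∀ g → Cover c hi lo _ _ g → ∃ λ w → Similar G V (varBound φ) (eval d w) g
          surj _ (on-cluster k refl) = let v , _ , _ , z = hit k in v , z
          surj _ (on-hi refl (y , s)) = y , ≡⇒Similar rtl V (eval-above s)
          surj _ (on-lo refl (y , s)) = y , ≡⇒Similar rtl V (eval-under s)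

          same : ∀ {w g} (p : Place w) → Cover c hi lo _ _ g → level p ≡ rk g →
                 ∃ λ v → w ≼ v × v ≼ w × Similar G V (varBound φ) (eval d v) g
          same (inside r s) (on-cluster k refl) _ =
            let v , r′ , s′ , z = hit k in v , ≼-trans s r′ , ≼-trans s′ r , z
          same (above s) (on-hi refl _) _ = _ , ≼-refl , ≼-refl , ≡⇒Similar rtl V (eval-above s)
          same (under s) (on-lo refl _) _ = _ , ≼-refl , ≼-refl , ≡⇒Similar rtl V (eval-under s)
          same (above _)    (on-cluster k refl) eq = contradiction (trans eq (rk-c k)) λ ()
          same (under _)    (on-cluster k refl) eq = contradiction (trans eq (rk-c k)) λ ()
          same (inside _ _) (on-hi refl h) eq = contradiction (trans eq (rk-hi h)) λ ()
          same (under _)    (on-hi refl h) eq = contradiction (trans eq (rk-hi h)) λ ()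
          same (inside _ _) (on-lo refl h) eq = contradiction (trans eq (rk-lo h)) λ ()
          same (above _)    (on-lo refl h) eq = contradiction (trans eq (rk-lo h)) λ ()

    -- Finite models

    Equivalent : World → World → Set
    Equivalent w v = ∀ φ → w ⊨ φ ⇔ v ⊨ φ

    eval-cong : ∀ {A} (d : Tree A) {w v} → Equivalent w v → eval d w ≡ eval d v
    eval-cong (leaf a) h = refl
    eval-cong (node φ d e) {w} h with T? (val w φ)
    ... | yes k = trans (eval-yes d e k) (trans (eval-cong d h) (sym (eval-yes d e (to (h φ) k))))
    ... | no ¬k = trans (eval-no d e ¬k) (trans (eval-cong e h) (sym (eval-no d e (¬k ∘ from (h φ)))))

    ≼-resp : ∀ {w w′ v v′} → Equivalent w w′ → Equivalent v v′ → w ≼ v → w′ ≼ v′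
    ≼-resp h k r = tight λ φ l → to (k φ) (to ⊨□ (from (h (□ φ)) l) _ r)

    AtMostPoints : ℕ → Set
    AtMostPoints N = ∀ l → AllPairs Apart l → length l ≤ N

    -- A list of separated worlds that cannot be extended meets every class of modal equivalence;
    -- `k` bounds the number of extensions still possible.
    enumerate : ∀ {N} → AtMostPoints N → ∀ k l → AllPairs Apart l → N ≤ length l + k →
                ∃ λ l → AllPairs Apart l × (∀ w → ∃ λ i → Equivalent w (lookup l i))
    enumerate b k l ps long with em₀ {∃ λ w → All (Apart w) l}
    enumerate b k l ps long | no n = l , ps , λ w →
      let a = All.¬All⇒Any¬ (λ _ → em₀) l (λ h → n (w , h))
      in Any.index a , ¬Apart-⊨ (Any.lookup-index a)
    enumerate b zero l ps long | yes (w , h) =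
      contradiction (ℕ.≤-trans (b (w ∷ l) (h ∷ ps)) (ℕ.≤-trans long (ℕ.≤-reflexive (ℕ.+-identityʳ _)))) ℕ.1+n≰n
    enumerate b (suc k) l ps long | yes (w , h) =
      enumerate b k (w ∷ l) (h ∷ ps) (ℕ.≤-trans long (ℕ.≤-reflexive (ℕ.+-suc _ k)))

    -- The frame is the quotient of `M` by modal equivalence. The quotient map is itself definable,
    -- so the frame validates `L`, and under the valuation read off from `M` it refutes whatever `M`
    -- refutes.
    finite-model : IsTenseLogic L → ∀ {N} → AtMostPoints N → World →
      ∃ λ k → k ≤ N × Σ (Vec (Vec Bool k) k) λ m →
        L ⊆ᴸ Log (matrixFrame m) × (∀ φ w → ¬ w ⊨ φ → ¬ Log (matrixFrame m) φ)
    finite-model L-tense {N} b w₀ =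
      length l , b l ps , m ,
      (λ φ h V g → definable-image L-tense rtl {V = V} d φ mono
         (λ g → let w , eq = surj g in w , ≡⇒Similar rtl V eq)
         (λ w g r s → let v , r′ , s′ , eq = same w g r s in v , r′ , s′ , ≡⇒Similar rtl V eq) h g) ,
      λ φ w n h → n (transport (w ⊨_) (subst-var φ) (to (truth var φ)
        (from (sat-bisim (monotone-bisim {F = frame} ≼-total rtl {V′ = V₀} f
                 (λ {w} {p} → nearest w (var p)) mono
                 (λ g → let w , eq = surj g in w , ≡⇒Similar rtl V₀ eq)
                 (λ w g r s → let v , r′ , s′ , eq = same w g r s in v , r′ , s′ , ≡⇒Similar rtl V₀ eq))
               φ (below φ ℕ.≤-refl) (Similar-refl rtl V₀))
              (h V₀ (f w)))))
      where
      points = enumerate b N [] [] ℕ.≤-refl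
      l   = proj₁ points
      ps  = proj₁ (proj₂ points)
      cov = proj₂ (proj₂ points)
      pt : Fin (length l) → World
      pt = lookup l
      m : Vec (Vec Bool (length l)) (length l)
      m = Vec.tabulate λ i → Vec.tabulate λ j → char (pt i ≼_) (pt j)
      G : Frame
      G = matrixFrame m
      R⇔ : ∀ {i j} → R G i j ⇔ pt i ≼ pt j
      R⇔ {i} {j} = transport (λ b → T b ⇔ pt i ≼ pt j)
        (sym (trans (cong (λ v → Vec.lookup v j) (Vec.lookup∘tabulate _ i)) (Vec.lookup∘tabulate _ j)))
        (char⇔ (pt i ≼_) (pt j))
      rtl : RTL G
      rtl = (λ i → from R⇔ ≼-refl) , (λ i j k r s → from R⇔ (≼-trans (to R⇔ r) (to R⇔ s))) ,
            λ i j → [ inj₁ ∘ from R⇔ , inj₂ ∘ from R⇔ ]′ (≼-total (pt i) (pt j))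
      -- The tree needs a default leaf; `w₀` supplies one by showing that `l` is nonempty.
      inner = interpolate ps (proj₁ (cov w₀)) id
      d = proj₁ inner
      f : World → Fin (length l)
      f = eval d
      V₀ : Valuation G
      V₀ p i = pt i ⊨ var p
      nearest : ∀ w → Equivalent w (pt (f w))
      nearest w = let i , h = cov w in
        transport (λ j → Equivalent w (pt j)) (sym (trans (eval-cong d h) (proj₂ inner i))) h
      farthest : ∀ w → Equivalent (pt (f w)) w
      farthest w φ = ⇔-sym (nearest w φ)
      mono : ∀ {w v} → w ≼ v → R G (f w) (f v)
      mono {w} {v} r = from R⇔ (≼-resp (nearest w) (nearest v) r)
      surj : ∀ g → ∃ λ w → f w ≡ g
      surj g = pt g , proj₂ inner g
      same : ∀ w g → R G (f w) g → R G g (f w) → ∃ λ v → w ≼ v × v ≼ w × f v ≡ g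
      same w g r s = pt g , ≼-resp (farthest w) (λ _ → ⇔-id _) (to R⇔ r) ,
                     ≼-resp (λ _ → ⇔-id _) (farthest w) (to R⇔ s) , proj₂ inner g

  -- Non-tabular logics

  -- Each step splits `S` by the truth of one variable, which leaves one representative for each
  -- realised type.
  representatives : ∀ {X : Set} (V : ℕ → X → Set) K (S : X → Set) →
    ∃ λ l → ∀ x → S x → Any (λ r → S r × (∀ p → p < K → V p x ⇔ V p r)) l
  representatives V zero S with em₀ {∃ S}
  ... | yes (r , s) = r ∷ [] , λ x _ → here (s , λ _ ())
  ... | no n        = [] , λ x s → contradiction (x , s) n
  representatives {X} V (suc K) S =
    let l , f = representatives V K (λ x → S x × V K x)
        k , g = representatives V K (λ x → S x × ¬ V K x)
    in l ++ k , go l f k g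
    where
    extend : ∀ {x r} → V K x ⇔ V K r → (∀ p → p < K → V p x ⇔ V p r) → ∀ p → p < suc K → V p x ⇔ V p r
    extend e h p p<K with ℕ.m<1+n⇒m<n∨m≡n p<K
    ... | inj₁ q    = h p q
    ... | inj₂ refl = e
    go : ∀ l → (∀ x → S x × V K x → Any (λ r → (S r × V K r) × (∀ p → p < K → V p x ⇔ V p r)) l) →
         ∀ k → (∀ x → S x × ¬ V K x → Any (λ r → (S r × ¬ V K r) × (∀ p → p < K → V p x ⇔ V p r)) k) →
         ∀ x → S x → Any (λ r → S r × (∀ p → p < suc K → V p x ⇔ V p r)) (l ++ k)
    go l f k g x s with em₀ {V K x}
    ... | yes v = Any.++⁺ˡ (Any.map (λ ((s , u) , h) → s , extend (mk⇔ (λ _ → u) (λ _ → v)) h) (f x (s , v)))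
    ... | no ¬v = Any.++⁺ʳ l (Any.map (λ ((s , ¬u) , h) → s , extend (mk⇔ (⊥-elim ∘ ¬v) (⊥-elim ∘ ¬u)) h) (g x (s , ¬v)))

  refutation : ∀ {L L′} → ¬ L ⊆ᴸ L′ → ∃ λ φ → L φ × ¬ L′ φ
  refutation n = dne₁ λ k → n λ φ h → dne₁ λ m → k (φ , h , m)

  module _ {L : Logic} (L-tense : IsTenseLogic L) where

    -- A theorem `φ` of `L` and a valuation refuting it in `G` are fixed first, so the bound, the
    -- number of representatives, is the same for all models. A larger cluster would transfer `φ` to
    -- `G`.
    cluster-bound : ∀ {G} (c : ℕ → W G) → ¬ L ⊆ᴸ Log G →
      ∃ λ m → ∀ (M : LinearModel L) → let open InModel M in
        ∀ {n} → (∀ x → ¬ Depth> n x) → ∀ x → ClusterFrame G c (∃ (x ≺_)) (∃ (_≺ x)) →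
        ∀ l → AllPairs Apart l → All (x ≼_) l → All (_≼ x) l → length l ≤ m
    cluster-bound {G} c n =
      let φ , h , ¬h = refutation n
          V , g , ¬s = dne₁ {∃ λ V → ∃ λ g → ¬ sat G V g φ} λ k → ¬h λ V g → dne λ ¬s → k (V , g , ¬s)
          reps , covers = representatives (λ p k → V p (c k)) (varBound φ) (λ _ → ⊤)
      in length reps , λ M bounded x C l ps above below → ℕ.≮⇒≥ λ m<l →
           ¬s (InModel.cluster-sound M bounded x L-tense ps above below C φ V reps
                 (λ k → Any.map proj₂ (covers k tt)) (ℕ.<⇒≤ m<l) h g)

    -- The disjoint union of the listed frames that validate `L`, built up from the empty frame, on
    -- which every formula is valid.
    common-frame : (fs : List (∃ BoolRel)) → ∃ λ k → Σ (BoolRel k) λ r →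
      (L ⊆ᴸ Log (finFrame k r)) ×
      (∀ {n s} → (n , s) ∈ fs → L ⊆ᴸ Log (finFrame n s) → Log (finFrame k r) ⊆ᴸ Log (finFrame n s))
    common-frame [] = 0 , (λ ()) , (λ _ _ _ ()) , λ ()
    common-frame ((n , s) ∷ fs) with em₁ {L ⊆ᴸ Log (finFrame n s)} | common-frame fs
    ... | no ¬i | k , r , i , f = k , r , i , λ { (here refl) j → contradiction j ¬i ; (there m) j → f m j }
    ... | yes i′ | k , r , i , f = n + k , sumRel s r ,
      (λ φ h → Log-sum s r {φ} (i′ φ h) (i φ h)) ,
      λ { (here refl) _ → Log-component (sumˡ s r)
        ; (there m) j φ h → f m j φ (Log-component (sumʳ s r) φ h) }

    bounded⇒tabular : S4∙3t ⊆ᴸ L → ∀ N → (∀ (M : LinearModel L) → InModel.AtMostPoints M N) → Tabular L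
    bounded⇒tabular S⊆L N b =
      let k , r , i , f = common-frame (finiteFrames N)
      in k , r , i , λ φ h → dne₁ λ n →
           let M , w , ¬s = Canonical.countermodel L-tense S⊆L n
               j , j≤N , m , incl , ref = InModel.finite-model M L-tense (b M) w
           in ref φ w ¬s (f (∈-finiteFrames j≤N m) incl φ h)

    ⊈five⇒tabular : S4∙3t ⊆ᴸ L → (∀ i → ¬ L ⊆ᴸ five i) → Tabular L
    ⊈five⇒tabular S⊆L n =
      let φ , h , ¬h = refutation (n 4F)
          d , ¬d = dne₁ {∃ λ d → ¬ Log (Chain (suc d)) φ} λ k → ¬h λ d → dne₁ λ ¬k → k (d , ¬k)
          m₀ , b₀ = cluster-bound c± (n 0F)
          m₁ , b₁ = cluster-bound c⁺ (n 1F)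
          m₂ , b₂ = cluster-bound c⁻ (n 2F)
          m₃ , b₃ = cluster-bound c∘ (n 3F)
      in bounded⇒tabular S⊆L _ λ M → let open InModel M
                                         shallow : ∀ x → ¬ Depth> d x
                                         shallow x c = ¬d (chain-sound L-tense c φ h)
        -- Which of the four bounds applies depends on whether worlds lie above and below `x`; the
        -- sum covers every case.
        in λ l ps → points-bounded {m = (m₀ + m₁) + (m₂ + m₃)} (λ x l ps r s →
             small M {x = x} {l = l} m₀ m₁ m₂ m₃
               (λ C → b₀ M shallow x C l ps r s) (λ C → b₁ M shallow x C l ps r s)
               (λ C → b₂ M shallow x C l ps r s) (λ C → b₃ M shallow x C l ps r s))
             d l ps (All.tabulate λ {x} _ → shallow x)
      where
      small : ∀ (M : LinearModel L) → let open InModel M in ∀ {x : World} {l : List World} m₀ m₁ m₂ m₃ →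
        (ClusterFrame C± c± (∃ (x ≺_)) (∃ (_≺ x)) → length l ≤ m₀) →
        (ClusterFrame C⁺ c⁺ (∃ (x ≺_)) (∃ (_≺ x)) → length l ≤ m₁) →
        (ClusterFrame C⁻ c⁻ (∃ (x ≺_)) (∃ (_≺ x)) → length l ≤ m₂) →
        (ClusterFrame C∘ c∘ (∃ (x ≺_)) (∃ (_≺ x)) → length l ≤ m₃) →
        length l ≤ (m₀ + m₁) + (m₂ + m₃)
      small M {x} m₀ m₁ m₂ m₃ b₀ b₁ b₂ b₃ with em₀ {∃ (InModel._≺_ M x)} | em₀ {∃ λ y → InModel._≺_ M y x}
      ... | yes h | yes k = ℕ.≤-trans (b₀ (C±-cluster h k)) (ℕ.≤-trans (ℕ.m≤m+n m₀ m₁) (ℕ.m≤m+n _ _))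
      ... | yes h | no k  = ℕ.≤-trans (b₁ (C⁺-cluster h k)) (ℕ.≤-trans (ℕ.m≤n+m m₁ m₀) (ℕ.m≤m+n _ _))
      ... | no h  | yes k = ℕ.≤-trans (b₂ (C⁻-cluster h k)) (ℕ.≤-trans (ℕ.m≤m+n m₂ m₃) (ℕ.m≤n+m _ (m₀ + m₁)))
      ... | no h  | no k  = ℕ.≤-trans (b₃ (C∘-cluster h k)) (ℕ.≤-trans (ℕ.m≤n+m m₃ m₂) (ℕ.m≤n+m _ (m₀ + m₁)))

  -- Pretabularity

  -- A failure gives for each `k ≤ n` a point where `var k` holds and no earlier variable does. Two
  -- of these `n + 1` points coincide, and there the smaller index contradicts the larger.
  pigeons-valid : ∀ n r → Log (finFrame n r) (pigeons n)
  pigeons-valid n r V x = from (sat-refutations F V _ (suc n)) λ h →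
    let seen : ∀ (i : Fin (suc n)) → ∃ λ y → V (toℕ i) y × (∀ j → j < toℕ i → ¬ V j y)
        seen i = dne λ k → h (toℕ i) (Fin.toℕ<n i) λ y _ v →
          from (sat-refutations F V (∼_ ∘ var) (toℕ i)) λ new → k (y , v , new)
        i , j , i<j , e = Fin.pigeonhole (ℕ.n<1+n n) (proj₁ ∘ seen)
    in proj₂ (proj₂ (seen j)) (toℕ i) i<j (transport (V (toℕ i)) e (proj₁ (proj₂ (seen i))))
    where F = finFrame n r

  five-tense : ∀ i → IsTenseLogic (five i)
  five-tense 0F = Log-tense C±
  five-tense 1F = Log-tense C⁺
  five-tense 2F = Log-tense C⁻
  five-tense 3F = Log-tense C∘
  five-tense 4F = ⋂-tense (Chain ∘ suc)

  tense-≐ : ∀ {L L′} → L ≐ L′ → IsTenseLogic L′ → IsTenseLogic L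
  tense-≐ (f , g) t = record
    { ax1   = λ φ ψ → g _ (ax1 t φ ψ)
    ; ax2   = λ φ ψ χ → g _ (ax2 t φ ψ χ)
    ; ax3   = λ φ → g _ (ax3 t φ)
    ; K□    = λ φ ψ → g _ (K□ t φ ψ)
    ; K𝐇    = λ φ ψ → g _ (K𝐇 t φ ψ)
    ; conv₁ = λ φ → g _ (conv₁ t φ)
    ; conv₂ = λ φ → g _ (conv₂ t φ)
    ; mp    = λ φ ψ h k → g _ (mp t φ ψ (f _ h) (f _ k))
    ; nec□  = λ φ h → g _ (nec□ t φ (f _ h))
    ; nec𝐇  = λ φ h → g _ (nec𝐇 t φ (f _ h))
    ; us    = λ σ φ h → g _ (us t σ φ (f _ h))
    }
    where open IsTenseLogic

  ¬tabular⇒⊆five : ∀ {L} → IsTenseLogic L → S4∙3t ⊆ᴸ L → ¬ Tabular L → ∃ λ i → L ⊆ᴸ five i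
  ¬tabular⇒⊆five t S⊆L n = dne₁ λ k → n (⊈five⇒tabular t S⊆L λ i s → k (i , s))

  -- Were the inclusion of `L` in `five i` proper, pretabularity would make `five i` tabular.
  PTAB⇒five : ∀ {L} → PTAB-S4∙3t L → ∃ λ i → L ≐ five i
  PTAB⇒five (t , S⊆L , ¬tab , ext) =
    let i , s = ¬tabular⇒⊆five t S⊆L ¬tab
        nontabular : ¬ Tabular (five i)
        nontabular (n , r , _ , h) = five-pigeons i n (h _ (pigeons-valid n r))
    in i , s , dne₁ λ k → nontabular (ext (five i) (five-tense i) s k (five-consistent i))

  five⇒PTAB : ∀ {L} i → L ≐ five i → PTAB-S4∙3t L
  five⇒PTAB i e@(f , g) = tense-≐ e (five-tense i) , (λ φ → g φ ∘ S4∙3t⊆five i φ) ,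
    (λ (n , r , _ , h) → five-pigeons i n (f _ (h _ (pigeons-valid n r)))) ,
    λ L′ t L⊆L′ proper _ → dne₁ λ n →
      -- A non-tabular extension `L′` lies below some `five j`; incomparability forces `j` to be
      -- `i`, so the extension is not proper.
      let j , s = ¬tabular⇒⊆five t (λ φ → L⊆L′ φ ∘ g φ ∘ S4∙3t⊆five i φ) n
      in proper λ φ → g φ ∘ transport (λ k → five k φ)
           (sym (five-incomparable i j λ ψ → s ψ ∘ L⊆L′ ψ ∘ g ψ)) ∘ s φ

theorem6p10 : ExcludedMiddle (lsuc (lsuc 0ℓ)) →
    ((L : Logic) →
    (PTAB-S4∙3t L → Σ (Fin 5) (λ i → L ≐ five i))
    × (Σ (Fin 5) (λ i → L ≐ five i) → PTAB-S4∙3t L))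
    × ((i j : Fin 5) → five i ≐ five j → i ≡ j)
theorem6p10 em = (λ L → PTAB⇒five , λ (i , e) → five⇒PTAB i e) , λ i j (s , _) → five-incomparable i j s
  where open Classical em
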